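{- For every integer $n\ge0$, $$c\phi_8(2n+1)\equiv0\pmod{64},\quad c\phi_8(4n+2)\equiv0\pmod{16},\quad c\phi_8(8n+4)\equiv0\pmod4,\quad c\phi_8(8n+6)\equiv0\pmod{64}.$$
   Context: A $k$-colored generalized Frobenius symbol is a two-row array with $d\ge 0$ columns whose entries are colored nonnegative integers $\ell_c$ ($\ell\ge 0$, color $c\in\{1,\dots,k\}$), each row strictly decreasing with respect to the total order $0_1\prec 0_2\prec\cdots\prec 0_k\prec 1_1\prec\cdots\prec 1_k\prec 2_1\prec\cdots$. It is a $k$-colored generalized Frobenius partition of $n=d+\sum(\text{integer values of all entries})$, and $c\phi_k(n)$ is the number of such partitions of $n$. -}

module Defs where

open import Data.Nat using (ℕ; _+_; _<_)
open import Data.Fin using (Fin)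
import Data.Fin as F
open import Data.Product using (_×_; Σ; _,_)
open import Data.Sum using (_⊎_)
open import Data.List using (List; length; map)
open import Data.Nat.ListAction using (sum)
open import Data.List.Relation.Unary.Linked using (Linked)
open import Relation.Binary.PropositionalEquality using (_≡_)

-- A k-colored nonnegative integer ℓ_c : value ℓ, color c ∈ {1..k} (as Fin k).
CInt : ℕ → Set
CInt k = ℕ × Fin k

value : ∀ {k} → CInt k → ℕ
value (ℓ , _) = ℓ

_≺_ : ∀ {k} → CInt k → CInt k → Set
(ℓ , c) ≺ (ℓ' , c') = (ℓ < ℓ') ⊎ ((ℓ ≡ ℓ') × (c F.< c'))

_≻_ : ∀ {k} → CInt k → CInt k → Set
x ≻ y = y ≺ x

StrictDec : ∀ {k} → List (CInt k) → Set
StrictDec = Linked _≻_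

record CFrob (k n : ℕ) : Set where
  constructor cfrob
  field
    top        : List (CInt k)
    bottom     : List (CInt k)
    top-dec    : StrictDec top
    bottom-dec : StrictDec bottom
    same-len   : length top ≡ length bottom
    weight     : length top + (sum (map value top) + sum (map value bottom)) ≡ n

{-# OPTIONS --safe #-}

-- Recording how many of the eight colours occur with each entry writes cφ₈(N) as a sum of products
-- of binomials 8 C a over the words of "occupation numbers" a of the modes of two fermionic rows.
-- The number of odd letters is even, and 8 ∣ 8 C a for odd a, so a term is divisible by 64 unless
-- all letters are even; halving the word and repeating the argument with 4 ∣ 8 C 2a and 2 ∣ 8 C 4a
-- for odd a gives the first three congruences term by term.
--
-- For N = 8n + 6 only the words with exactly two letters 2, 6 and all other letters in {0, 4, 8}
-- survive mod 64, and their sum is ≡ 16 · 49 · S.  Writing the unmarked letters as 4 (c + d) with bits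
-- c, d, the two marks at distance h become a particle of the Maya diagram d that jumps up by h, so S
-- counts pairs of Maya diagrams with an addable h-hook, h odd.  A Maya diagram has h more addable
-- than removable h-hooks, and adding a hook is the inverse of removing one; iterating,
-- S = Σ (1 + 2u) · c((1 + 2u)(1 + 2v)) where c(y) counts the pairs of Maya diagrams whose energy is
-- N / 4 - y / 2.  By parity 4 ∣ c((1 + 2u)(1 + 2v)) when u + v is even; when u + v is odd the
-- summands for (u, v) and (v, u) add up to a multiple of 2 (1 + u + v).  Hence 4 ∣ S.

module Submission where

open import Defs
open import Data.Bool using (Bool; true; false; not; if_then_else_)
open import Data.Empty using (⊥-elim)
open import Data.Fin using (Fin)
import Data.Fin as Fin
import Data.Fin.Properties as Fin
open import Data.List using (List; []; _∷_; map; _++_; concatMap; upTo; applyUpTo; length)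
open import Data.List.Membership.Propositional using (_∈_)
open import Data.List.Membership.Propositional.Properties using (∈-map⁺; ∈-++⁺ˡ; ∈-++⁺ʳ)
open import Data.List.Properties using (map-++; map-∘; map-cong; map-applyUpTo; upTo-∷ʳ; length-map; length-++)
open import Data.List.Relation.Binary.Sublist.Propositional using (_⊆_; []; _∷_; _∷ʳ_; minimum)
open import Data.List.Relation.Unary.All as All using (All; []; _∷_)
import Data.List.Relation.Unary.All.Properties as All
open import Data.List.Relation.Unary.AllPairs as AllPairs using (AllPairs; []; _∷_)
import Data.List.Relation.Unary.AllPairs.Properties as AllPairs
open import Data.List.Relation.Unary.Any using (here; there)
import Data.List.Relation.Unary.Linked as Linked
open import Data.List.Relation.Unary.Linked.Properties using (Linked⇒AllPairs; AllPairs⇒Linked)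
open import Data.Nat
open import Data.Nat.Combinatorics using (_C_; nCk+nC[k+1]≡[n+1]C[k+1]; k>n⇒nCk≡0; nCk≡nC[n∸k])
open import Data.Nat.Divisibility
open import Data.Nat.ListAction using (sum)
open import Data.Nat.ListAction.Properties using (sum-++)
open import Data.Nat.Properties
open import Data.Nat.Tactic.RingSolver using (solve-∀)
open import Data.Product using (Σ; _×_; _,_; ∃; proj₁; proj₂)
open import Data.Product.Function.NonDependent.Propositional using (_×-↔_)
open import Data.Sum using (_⊎_; inj₁; inj₂)
open import Data.Sum.Function.Propositional using (_⊎-↔_)
open import Data.Vec as Vec using (Vec; []; _∷_)
open import Function using (_∘_)
open import Function.Bundles using (_↔_; mk↔ₛ′)
open import Function.Properties.Inverse using (↔-refl; ↔-sym; ↔-trans)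
open import Relation.Nullary using (¬_; yes; no; contradiction)
open import Relation.Nullary.Decidable using (from-yes; from-no)
open import Relation.Binary.PropositionalEquality
open ≡-Reasoning

private variable
  A B : Set
  n : ℕ

-- Finite sums over lists

opaque
  -- Opaque so that sums over concrete lists such as `upTo 9` stay folded during type checking; the
  -- few evaluations needed are made under `unfolding`.
  ∑ : List A → (A → ℕ) → ℕ
  ∑ xs f = sum (map f xs)

  ∑-cong : (xs : List A) {f g : A → ℕ} → (∀ x → f x ≡ g x) → ∑ xs f ≡ ∑ xs g
  ∑-cong xs eq = cong sum (map-cong eq xs)

  ∑-++ : (xs ys : List A) (f : A → ℕ) → ∑ (xs ++ ys) f ≡ ∑ xs f + ∑ ys f
  ∑-++ xs ys f = trans (cong sum (map-++ f xs ys)) (sum-++ (map f xs) (map f ys))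

  ∑-map : (h : A → B) (xs : List A) (f : B → ℕ) → ∑ (map h xs) f ≡ ∑ xs (f ∘ h)
  ∑-map h xs f = cong sum (sym (map-∘ xs))

  ∑-concatMap : (h : A → List B) (xs : List A) (f : B → ℕ) →
    ∑ (concatMap h xs) f ≡ ∑ xs (λ x → ∑ (h x) f)
  ∑-concatMap h []       f = refl
  ∑-concatMap h (x ∷ xs) f =
    trans (∑-++ (h x) (concatMap h xs) f) (cong (∑ (h x) f +_) (∑-concatMap h xs f))

  ∑-zero : (xs : List A) → ∑ xs (λ _ → 0) ≡ 0
  ∑-zero []       = refl
  ∑-zero (x ∷ xs) = ∑-zero xs

  ∑-+ : (xs : List A) (f g : A → ℕ) → ∑ xs (λ x → f x + g x) ≡ ∑ xs f + ∑ xs g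
  ∑-+ []       f g = refl
  ∑-+ (x ∷ xs) f g = trans (cong (f x + g x +_) (∑-+ xs f g)) (interchange (f x) (g x) _ _)
    where
    interchange : ∀ a b c d → a + b + (c + d) ≡ a + c + (b + d)
    interchange = solve-∀

  ∑-*ˡ : (xs : List A) (c : ℕ) (f : A → ℕ) → ∑ xs (λ x → c * f x) ≡ c * ∑ xs f
  ∑-*ˡ []       c f = sym (*-zeroʳ c)
  ∑-*ˡ (x ∷ xs) c f = trans (cong (c * f x +_) (∑-*ˡ xs c f)) (sym (*-distribˡ-+ c (f x) _))

  ∑-comm : (xs : List A) (ys : List B) (f : A → B → ℕ) →
    ∑ xs (λ x → ∑ ys (f x)) ≡ ∑ ys (λ y → ∑ xs (λ x → f x y))
  ∑-comm []       ys f = sym (∑-zero ys)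
  ∑-comm (x ∷ xs) ys f =
    trans (cong (∑ ys (f x) +_) (∑-comm xs ys f)) (sym (∑-+ ys (f x) _))

  ∑-∣ : (d : ℕ) (xs : List A) {f : A → ℕ} → (∀ x → d ∣ f x) → d ∣ ∑ xs f
  ∑-∣ d []       h = d ∣0
  ∑-∣ d (x ∷ xs) h = ∣m∣n⇒∣m+n (h x) (∑-∣ d xs h)

  ∑-[] : (f : A → ℕ) → ∑ [] f ≡ 0
  ∑-[] f = refl

  ∑-single : (x : A) (f : A → ℕ) → ∑ (x ∷ []) f ≡ f x
  ∑-single x f = +-identityʳ (f x)

  ∑-∷ : (x : A) (xs : List A) (f : A → ℕ) → ∑ (x ∷ xs) f ≡ f x + ∑ xs f
  ∑-∷ x xs f = refl

∑-upTo-suc : ∀ n (f : ℕ → ℕ) → ∑ (upTo (suc n)) f ≡ f 0 + ∑ (upTo n) (f ∘ suc)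
∑-upTo-suc n f = trans (∑-∷ 0 (applyUpTo suc n) f) (cong (f 0 +_)
  (trans (cong (λ xs → ∑ xs f) (sym (map-applyUpTo (λ k → k) suc n))) (∑-map suc (upTo n) f)))

∑-upTo-last : ∀ n (f : ℕ → ℕ) → ∑ (upTo (suc n)) f ≡ ∑ (upTo n) f + f n
∑-upTo-last n f = begin
  ∑ (upTo (suc n)) f        ≡⟨ cong (λ xs → ∑ xs f) (sym (upTo-∷ʳ n)) ⟩
  ∑ (upTo n ++ n ∷ []) f    ≡⟨ ∑-++ (upTo n) (n ∷ []) f ⟩
  ∑ (upTo n) f + ∑ (n ∷ []) f  ≡⟨ cong (∑ (upTo n) f +_) (∑-single n f) ⟩
  ∑ (upTo n) f + f n        ∎

∑-upTo-+ : ∀ m n (f : ℕ → ℕ) → ∑ (upTo (m + n)) f ≡ ∑ (upTo m) f + ∑ (upTo n) (λ j → f (m + j))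
∑-upTo-+ zero    n f = sym (cong (_+ ∑ (upTo n) f) (∑-[] f))
∑-upTo-+ (suc m) n f = begin
  ∑ (upTo (suc m + n)) f                                            ≡⟨ ∑-upTo-suc (m + n) f ⟩
  f 0 + ∑ (upTo (m + n)) (f ∘ suc)                                  ≡⟨ cong (f 0 +_) (∑-upTo-+ m n (f ∘ suc)) ⟩
  f 0 + (∑ (upTo m) (f ∘ suc) + ∑ (upTo n) (λ j → f (suc m + j)))   ≡⟨ +-assoc (f 0) _ _ ⟨
  f 0 + ∑ (upTo m) (f ∘ suc) + ∑ (upTo n) (λ j → f (suc m + j))     ≡⟨ cong (_+ ∑ (upTo n) (λ j → f (suc m + j))) (∑-upTo-suc m f) ⟨
  ∑ (upTo (suc m)) f + ∑ (upTo n) (λ j → f (suc m + j))             ∎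

-- Pascal's rule: a choice from `suc n` colours skips the new colour or takes it, which advances the
-- argument of `g`. The surplus top term carries `n C suc n`, which is `0`.
∑-binomial-suc : ∀ n (g : ℕ → ℕ) →
  ∑ (upTo (suc (suc n))) (λ a → (suc n C a) * g a) ≡
  ∑ (upTo (suc n)) (λ a → (n C a) * g a) + ∑ (upTo (suc n)) (λ a → (n C a) * g (suc a))
∑-binomial-suc n g = begin
  ∑ (upTo (suc (suc n))) (λ a → (suc n C a) * g a)
    ≡⟨ ∑-upTo-suc (suc n) _ ⟩
  1 * g 0 + ∑ (upTo (suc n)) (λ a → (suc n C suc a) * g (suc a))
    ≡⟨ cong (1 * g 0 +_) (trans (∑-cong (upTo (suc n)) pascal) (∑-+ (upTo (suc n)) _ _)) ⟩
  1 * g 0 + (S + ∑ (upTo (suc n)) (λ a → (n C suc a) * g (suc a)))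
    ≡⟨ rearrange (1 * g 0) S _ ⟩
  1 * g 0 + ∑ (upTo (suc n)) (λ a → (n C suc a) * g (suc a)) + S
    ≡⟨ cong (_+ S) (∑-upTo-suc (suc n) (λ a → (n C a) * g a)) ⟨
  ∑ (upTo (suc (suc n))) (λ a → (n C a) * g a) + S
    ≡⟨ cong (_+ S) (∑-upTo-last (suc n) (λ a → (n C a) * g a)) ⟩
  ∑ (upTo (suc n)) (λ a → (n C a) * g a) + (n C suc n) * g (suc n) + S
    ≡⟨ cong (λ c → ∑ (upTo (suc n)) (λ a → (n C a) * g a) + c * g (suc n) + S) (k>n⇒nCk≡0 (n<1+n n)) ⟩
  ∑ (upTo (suc n)) (λ a → (n C a) * g a) + 0 + S
    ≡⟨ cong (_+ S) (+-identityʳ (∑ (upTo (suc n)) (λ a → (n C a) * g a))) ⟩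
  ∑ (upTo (suc n)) (λ a → (n C a) * g a) + S ∎
  where
  S : ℕ
  S = ∑ (upTo (suc n)) (λ a → (n C a) * g (suc a))
  pascal : ∀ a → (suc n C suc a) * g (suc a) ≡ (n C a) * g (suc a) + (n C suc a) * g (suc a)
  pascal a = trans (cong (_* g (suc a)) (sym (nCk+nC[k+1]≡[n+1]C[k+1] n a)))
                   (*-distribʳ-+ (g (suc a)) (n C a) (n C suc a))
  rearrange : ∀ x y z → x + (y + z) ≡ x + z + y
  rearrange = solve-∀

-- Words and their statistics

words : List A → ∀ n → List (Vec A n)
words xs zero    = [] ∷ []
words xs (suc n) = concatMap (λ x → map (x ∷_) (words xs n)) xs

∑-words-suc : ∀ n (xs : List A) (f : Vec A (suc n) → ℕ) →
  ∑ (words xs (suc n)) f ≡ ∑ xs (λ x → ∑ (words xs n) (λ v → f (x ∷ v)))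
∑-words-suc n xs f = trans (∑-concatMap _ xs f) (∑-cong xs (λ x → ∑-map (x ∷_) (words xs _) f))

total : Vec ℕ n → ℕ
total []      = 0
total (a ∷ v) = a + total v

-- The first letter sits at position b.
moment : ℕ → Vec ℕ n → ℕ
moment b []      = 0
moment b (a ∷ v) = b * a + moment (suc b) v

weigh : (ℕ → ℕ) → Vec ℕ n → ℕ
weigh w []      = 1
weigh w (a ∷ v) = w a * weigh w v

-- Stores in the test the total and the moment of the letters already read, so that recursions on
-- words need no accumulators.
shift : ℕ → ℕ → (ℕ → ℕ → ℕ) → ℕ → ℕ → ℕ
shift c s φ c' s' = φ (c + c') (s + s')

-- With `φ` a product of deltas this is a coefficient of the product, over the positions `i` from
-- `b` to `b + n - 1`, of the polynomials with terms `w a * z^a * q^(i * a)`, `a ≤ m`.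
stateSum : (w : ℕ → ℕ) (m b n : ℕ) → (ℕ → ℕ → ℕ) → ℕ
stateSum w m b n φ = ∑ (words (upTo (suc m)) n) (λ v → weigh w v * φ (total v) (moment b v))

stateSum-zero : ∀ w m b φ → stateSum w m b 0 φ ≡ φ 0 0
stateSum-zero w m b φ = trans (∑-single [] _) (+-identityʳ (φ 0 0))

stateSum-suc : ∀ w m b n φ →
  stateSum w m b (suc n) φ ≡ ∑ (upTo (suc m)) (λ a → w a * stateSum w m (suc b) n (shift a (b * a) φ))
stateSum-suc w m b n φ = trans (∑-words-suc n (upTo (suc m)) _) (∑-cong (upTo (suc m)) λ a →
  trans (∑-cong (words (upTo (suc m)) n) (λ v → *-assoc (w a) (weigh w v) _)) (∑-*ˡ (words (upTo (suc m)) n) (w a) _))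

stateSum-cong : ∀ w m b n {φ ψ} → (∀ c s → φ c s ≡ ψ c s) → stateSum w m b n φ ≡ stateSum w m b n ψ
stateSum-cong w m b n eq = ∑-cong (words (upTo (suc m)) n) (λ v → cong (weigh w v *_) (eq _ _))

stateSum-+ : ∀ w m b n k φ →
  stateSum w m b (n + k) φ ≡ stateSum w m b n (λ c s → stateSum w m (b + n) k (shift c s φ))
stateSum-+ w m b zero    k φ = trans (cong (λ b → stateSum w m b k φ) (sym (+-identityʳ b)))
  (sym (stateSum-zero w m b λ c s → stateSum w m (b + zero) k (shift c s φ)))
stateSum-+ w m b (suc n) k φ = begin
  stateSum w m b (suc n + k) φ
    ≡⟨ stateSum-suc w m b (n + k) φ ⟩
  ∑ (upTo (suc m)) (λ a → w a * stateSum w m (suc b) (n + k) (shift a (b * a) φ))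
    ≡⟨ ∑-cong (upTo (suc m)) (λ a → cong (w a *_) (trans (stateSum-+ w m (suc b) n k (shift a (b * a) φ))
         (stateSum-cong w m (suc b) n (λ c s → trans
           (cong (λ b → stateSum w m b k (shift c s (shift a (b' a) φ))) (sym (+-suc b n)))
           (stateSum-cong w m (b + suc n) k (λ c' s' →
             cong₂ φ (sym (+-assoc a c c')) (sym (+-assoc (b' a) s s')))))))) ⟩
  ∑ (upTo (suc m)) (λ a → w a * stateSum w m (suc b) n (shift a (b * a) λ c s → stateSum w m (b + suc n) k (shift c s φ)))
    ≡⟨ stateSum-suc w m b n (λ c s → stateSum w m (b + suc n) k (shift c s φ)) ⟨
  stateSum w m b (suc n) (λ c s → stateSum w m (b + suc n) k (shift c s φ)) ∎
  where
  b' : ℕ → ℕ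
  b' a = b * a

stateSum-translate : ∀ w m b n φ → stateSum w m b n φ ≡ stateSum w m 0 n (λ c s → φ c (b * c + s))
stateSum-translate w m b n φ = ∑-cong (words (upTo (suc m)) n)
  (λ v → cong (λ s → weigh w v * φ (total v) s) (moment-translate 0 v))
  where
  step : ∀ b k a t s → (k + b) * a + (b * t + s) ≡ b * (a + t) + (k * a + s)
  step = solve-∀
  moment-translate : ∀ {l} k (v : Vec ℕ l) → moment (k + b) v ≡ b * total v + moment k v
  moment-translate k []      = sym (trans (+-identityʳ (b * 0)) (*-zeroʳ b))
  moment-translate k (a ∷ v) = trans (cong ((k + b) * a +_) (moment-translate (suc k) v)) (step b k a (total v) _)

-- Reads the letters from the highest position `n - 1` downwards, the order in which `modes` lists
-- the entries.
downSum : (w : ℕ → ℕ) (m n : ℕ) → (ℕ → ℕ → ℕ) → ℕ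
downSum w m zero    φ = φ 0 0
downSum w m (suc n) φ = ∑ (upTo (suc m)) (λ a → w a * downSum w m n (shift a (n * a) φ))

-- After the induction hypothesis the first letter still sits at the top position `n`; exchanging
-- the two sums moves it to the end of the word, where `stateSum-+` reads it.
downSum≡stateSum : ∀ w m n φ → downSum w m n φ ≡ stateSum w m 0 n φ
downSum≡stateSum w m zero    φ = sym (stateSum-zero w m 0 φ)
downSum≡stateSum w m (suc n) φ = begin
  ∑ (upTo (suc m)) (λ a → w a * downSum w m n (shift a (n * a) φ))
    ≡⟨ ∑-cong (upTo (suc m)) (λ a → cong (w a *_) (downSum≡stateSum w m n _)) ⟩
  ∑ (upTo (suc m)) (λ a → w a * stateSum w m 0 n (shift a (n * a) φ))
    ≡⟨ ∑-cong (upTo (suc m)) (λ a → sym (∑-*ˡ (words (upTo (suc m)) n) (w a) _)) ⟩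
  ∑ (upTo (suc m)) (λ a → ∑ (words (upTo (suc m)) n) (λ v → w a * (weigh w v * φ (a + total v) (n * a + moment 0 v))))
    ≡⟨ ∑-comm (upTo (suc m)) (words (upTo (suc m)) n) _ ⟩
  ∑ (words (upTo (suc m)) n) (λ v → ∑ (upTo (suc m)) (λ a → w a * (weigh w v * φ (a + total v) (n * a + moment 0 v))))
    ≡⟨ ∑-cong (words (upTo (suc m)) n) (λ v → trans (∑-cong (upTo (suc m)) (λ a → regroup (w a) (weigh w v) a (total v) (n * a) (moment 0 v)))
                                                   (∑-*ˡ (upTo (suc m)) (weigh w v) _)) ⟩
  stateSum w m 0 n (λ c s → ∑ (upTo (suc m)) (λ a → w a * φ (c + a) (s + n * a)))
    ≡⟨ stateSum-cong w m 0 n (λ c s → sym (lastLetter c s)) ⟩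
  stateSum w m 0 n (λ c s → stateSum w m n 1 (shift c s φ))
    ≡⟨ stateSum-+ w m 0 n 1 φ ⟨
  stateSum w m 0 (n + 1) φ
    ≡⟨ cong (λ k → stateSum w m 0 k φ) (+-comm n 1) ⟩
  stateSum w m 0 (suc n) φ ∎
  where
  regroup : ∀ x y a t p q → x * (y * φ (a + t) (p + q)) ≡ y * (x * φ (t + a) (q + p))
  regroup x y a t p q rewrite +-comm a t | +-comm p q = assoc x y (φ (t + a) (q + p))
    where
    assoc : ∀ x y z → x * (y * z) ≡ y * (x * z)
    assoc = solve-∀
  lastLetter : ∀ c s → stateSum w m n 1 (shift c s φ) ≡ ∑ (upTo (suc m)) (λ a → w a * φ (c + a) (s + n * a))
  lastLetter c s = trans (stateSum-suc w m n 0 (shift c s φ)) (∑-cong (upTo (suc m)) λ a → cong (w a *_)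
    (trans (stateSum-zero w m (suc n) (shift a (n * a) (shift c s φ))) (cong₂ (λ x y → φ (c + x) (s + y)) (+-identityʳ a) (+-identityʳ (n * a)))))

-- Frobenius partitions as pairs of sublists of the list of modes

sublists : List A → List (List A)
sublists []       = [] ∷ []
sublists (x ∷ xs) = sublists xs ++ map (x ∷_) (sublists xs)

∑-sublists-∷ : (x : A) (xs : List A) (f : List A → ℕ) →
  ∑ (sublists (x ∷ xs)) f ≡ ∑ (sublists xs) f + ∑ (sublists xs) (λ l → f (x ∷ l))
∑-sublists-∷ x xs f = trans (∑-++ (sublists xs) _ f) (cong (∑ (sublists xs) f +_) (∑-map (x ∷_) (sublists xs) f))

≡⇒↔ : ∀ {m n} → m ≡ n → Fin m ↔ Fin n
≡⇒↔ refl = ↔-refl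

-- `P l` may itself be a sum type of this form, so two nested uses enumerate pairs of rows. What is
-- counted are embeddings `l ⊆ xs`; their uniqueness is the matter of `⊆-irrelevant`.
sublists-↔ : (xs : List A) {P : List A → Set} (f : List A → ℕ) → (∀ l → P l ↔ Fin (f l)) →
  (Σ (List A) λ l → l ⊆ xs × P l) ↔ Fin (∑ (sublists xs) f)
sublists-↔ [] {P} f h = ↔-trans
  (mk↔ₛ′ {B = P []} (λ { ([] , [] , p) → p }) (λ p → [] , [] , p) (λ _ → refl) (λ { ([] , [] , p) → refl }))
  (↔-trans (h []) (≡⇒↔ (sym (∑-single [] f))))
sublists-↔ {A} (x ∷ xs) {P} f h =
  ↔-trans splitHead (↔-trans (sublists-↔ xs f h ⊎-↔ sublists-↔ xs (f ∘ (x ∷_)) (h ∘ (x ∷_)))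
    (↔-trans (↔-sym Fin.+↔⊎) (≡⇒↔ (sym (∑-sublists-∷ x xs f)))))
  where
  Sub : (List A → Set) → Set
  Sub Q = Σ (List A) λ l → l ⊆ xs × Q l
  splitHead : (Σ (List A) λ l → l ⊆ (x ∷ xs) × P l) ↔ (Sub P ⊎ Sub (P ∘ (x ∷_)))
  splitHead = mk↔ₛ′
    (λ { (l , (.x ∷ʳ s) , p) → inj₁ (l , s , p) ; (.x ∷ l , (refl ∷ s) , p) → inj₂ (l , s , p) })
    (λ { (inj₁ (l , s , p)) → l , x ∷ʳ s , p ; (inj₂ (l , s , p)) → x ∷ l , refl ∷ s , p })
    (λ { (inj₁ _) → refl ; (inj₂ _) → refl })
    (λ { (l , (.x ∷ʳ s) , p) → refl ; (.x ∷ l , (refl ∷ s) , p) → refl })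

All-⊆ : ∀ {P : A → Set} {l xs} → l ⊆ xs → All P xs → All P l
All-⊆ []         []         = []
All-⊆ (x ∷ʳ s)   (_ ∷ ps)   = All-⊆ s ps
All-⊆ (refl ∷ s) (p ∷ ps)   = p ∷ All-⊆ s ps

AllPairs-⊆ : ∀ {R : A → A → Set} {l xs} → l ⊆ xs → AllPairs R xs → AllPairs R l
AllPairs-⊆ []         []       = []
AllPairs-⊆ (x ∷ʳ s)   (_ ∷ rs) = AllPairs-⊆ s rs
AllPairs-⊆ (refl ∷ s) (r ∷ rs) = All-⊆ s r ∷ AllPairs-⊆ s rs

module _ {R : A → A → Set} (R-irrefl : ∀ {x} → ¬ R x x) where

  private
    head∉ : ∀ {x xs l} → All (R x) xs → ¬ (x ∷ l) ⊆ xs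
    head∉ rs s with All-⊆ s rs
    ... | r ∷ _ = R-irrefl r

  -- Irreflexivity forbids repetitions in `xs`, so the head of the sublist cannot be matched both at
  -- the head of `xs` and further on.
  ⊆-irrelevant : ∀ {l xs} → AllPairs R xs → (s t : l ⊆ xs) → s ≡ t
  ⊆-irrelevant []       []         []         = refl
  ⊆-irrelevant (r ∷ rs) (x ∷ʳ s)   (.x ∷ʳ t)  = cong (x ∷ʳ_) (⊆-irrelevant rs s t)
  ⊆-irrelevant (r ∷ rs) (refl ∷ s) (refl ∷ t) = cong (refl ∷_) (⊆-irrelevant rs s t)
  ⊆-irrelevant (r ∷ rs) (x ∷ʳ s)   (refl ∷ t) = ⊥-elim (head∉ r s)
  ⊆-irrelevant (r ∷ rs) (refl ∷ s) (x ∷ʳ t)   = ⊥-elim (head∉ r t)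

  module _ (R-trans : ∀ {x y z} → R x y → R y z → R x z) where

    private
      below : ∀ {x xs l} → All (R x) l → All (_∈ x ∷ xs) l → All (_∈ xs) l
      below []       []               = []
      below (r ∷ rs) (here refl ∷ ms) = ⊥-elim (R-irrefl r)
      below (r ∷ rs) (there m ∷ ms)   = m ∷ below rs ms

    -- If the head of `l` lies in the tail of `xs`, transitivity puts every later element of `l`
    -- strictly beyond the head of `xs` too, so that head can be skipped for good.
    sorted⇒⊆ : ∀ {l xs} → AllPairs R xs → AllPairs R l → All (_∈ xs) l → l ⊆ xs
    sorted⇒⊆ {xs = xs} rs []       []               = minimum xs
    sorted⇒⊆ (r ∷ rs) (q ∷ qs) (here refl ∷ ms) = refl ∷ sorted⇒⊆ rs qs (below q ms)
    sorted⇒⊆ (r ∷ rs) (q ∷ qs) (there m ∷ ms)   =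
      _ ∷ʳ sorted⇒⊆ rs (q ∷ qs) (m ∷ below (All.map (R-trans (All.lookup r m)) q) ms)

colours : ∀ k → List (Fin k)
colours zero    = []
colours (suc k) = map Fin.suc (colours k) ++ Fin.zero ∷ []

-- Listed in decreasing order for `≻`, so that the strictly decreasing rows with values below `K`
-- are exactly the sublists.
modes : ∀ k → ℕ → List (CInt k)
modes k zero    = []
modes k (suc K) = map (K ,_) (colours k) ++ modes k K

length-colours : ∀ k → length (colours k) ≡ k
length-colours zero    = refl
length-colours (suc k) = begin
  length (map Fin.suc (colours k) ++ Fin.zero ∷ []) ≡⟨ length-++ (map Fin.suc (colours k)) ⟩
  length (map Fin.suc (colours k)) + 1              ≡⟨ cong (_+ 1) (length-map Fin.suc (colours k)) ⟩
  length (colours k) + 1                            ≡⟨ cong (_+ 1) (length-colours k) ⟩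
  k + 1                                             ≡⟨ +-comm k 1 ⟩
  suc k                                             ∎

∈-colours : ∀ {k} (c : Fin k) → c ∈ colours k
∈-colours Fin.zero    = ∈-++⁺ʳ (map Fin.suc (colours _)) (here refl)
∈-colours (Fin.suc c) = ∈-++⁺ˡ (∈-map⁺ Fin.suc (∈-colours c))

∈-modes : ∀ {k} K {ℓ} (c : Fin k) → ℓ < K → (ℓ , c) ∈ modes k K
∈-modes (suc K) {ℓ} c (s≤s ℓ≤K) with m≤n⇒m<n∨m≡n ℓ≤K
... | inj₁ ℓ<K  = ∈-++⁺ʳ (map (K ,_) (colours _)) (∈-modes K c ℓ<K)
... | inj₂ refl = ∈-++⁺ˡ (∈-map⁺ (K ,_) (∈-colours c))

colours-decreasing : ∀ k → AllPairs Fin._>_ (colours k)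
colours-decreasing zero    = []
colours-decreasing (suc k) = AllPairs.++⁺ (AllPairs.map⁺ (AllPairs.map s≤s (colours-decreasing k))) ([] ∷ [])
  (All.map⁺ (All.universal (λ _ → z<s ∷ []) (colours k)))

value<K : ∀ k K → All (λ x → value x < K) (modes k K)
value<K k zero    = []
value<K k (suc K) = All.++⁺ (All.map⁺ (All.universal (λ _ → n<1+n K) (colours k))) (All.map m<n⇒m<1+n (value<K k K))

modes-decreasing : ∀ k K → AllPairs _≻_ (modes k K)
modes-decreasing k zero    = []
modes-decreasing k (suc K) = AllPairs.++⁺
  (AllPairs.map⁺ (AllPairs.map (λ c>c′ → inj₂ (refl , c>c′)) (colours-decreasing k))) (modes-decreasing k K)
  (All.map⁺ (All.universal (λ _ → All.map inj₁ (value<K k K)) (colours k)))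

≻-irrefl : ∀ {k} {x : CInt k} → ¬ x ≻ x
≻-irrefl (inj₁ ℓ<ℓ)       = <-irrefl refl ℓ<ℓ
≻-irrefl (inj₂ (_ , c<c)) = <-irrefl refl c<c

≻-trans : ∀ {k} {x y z : CInt k} → x ≻ y → y ≻ z → x ≻ z
≻-trans (inj₁ p)          (inj₁ q)          = inj₁ (<-trans q p)
≻-trans (inj₁ p)          (inj₂ (refl , q)) = inj₁ p
≻-trans (inj₂ (refl , p)) (inj₁ q)          = inj₁ q
≻-trans (inj₂ (refl , p)) (inj₂ (refl , q)) = inj₂ (refl , <-trans q p)

-- `CFrob` stores the proofs that its rows decrease; uniqueness of these proofs ensures that each
-- pair of rows is counted once.
≻-irrelevant : ∀ {k} {x y : CInt k} (p q : x ≻ y) → p ≡ q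
≻-irrelevant (inj₁ p)       (inj₁ q)        = cong inj₁ (<-irrelevant p q)
≻-irrelevant (inj₁ p)       (inj₂ (e , _))  = ⊥-elim (<-irrefl e p)
≻-irrelevant (inj₂ (e , _)) (inj₁ q)        = ⊥-elim (<-irrefl e q)
≻-irrelevant (inj₂ (e , p)) (inj₂ (e′ , q)) = cong inj₂ (cong₂ _,_ (≡-irrelevant e e′) (<-irrelevant p q))

δ : ℕ → ℕ → ℕ
δ m n = if m ≡ᵇ n then 1 else 0

-- Equality in `ℕ` is a proposition, so it has one element or none. This turns the conditions on a
-- pair of rows into factors of the counting sum.
δ-↔ : ∀ m n → (m ≡ n) ↔ Fin (δ m n)
δ-↔ zero    zero    = mk↔ₛ′ (λ _ → Fin.zero) (λ _ → refl) (λ { Fin.zero → refl ; (Fin.suc ()) }) (λ { refl → refl })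
δ-↔ zero    (suc n) = mk↔ₛ′ (λ ()) (λ ()) (λ ()) (λ ())
δ-↔ (suc m) zero    = mk↔ₛ′ (λ ()) (λ ()) (λ ()) (λ ())
δ-↔ (suc m) (suc n) = ↔-trans (mk↔ₛ′ suc-injective (cong suc) (λ _ → ≡-irrelevant _ _) (λ _ → ≡-irrelevant _ _)) (δ-↔ m n)

Weight : ∀ {k} → List (CInt k) → List (CInt k) → ℕ
Weight t b = length t + (sum (map value t) + sum (map value b))

-- No entry of a partition of `N` exceeds `N`, so the modes of value below `suc N` suffice. The
-- bottom row is the outer sum because it is the one that gets complemented later.
frobSum : ℕ → ℕ → ℕ
frobSum k N = ∑ (sublists (modes k (suc N))) λ b → ∑ (sublists (modes k (suc N))) λ t →
  δ (length t) (length b) * δ (Weight t b) N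

CFrob-↔ : ∀ k N → CFrob k N ↔ Fin (frobSum k N)
CFrob-↔ k N = ↔-trans
  (mk↔ₛ′ to from
    (λ { (b , s , t , s′ , e , w) → cong₂ (λ u v → b , u , t , v , e , w)
       (⊆-irrelevant ≻-irrefl (modes-decreasing k (suc N)) _ s) (⊆-irrelevant ≻-irrefl (modes-decreasing k (suc N)) _ s′) })
    (λ { (cfrob t b td bd e w) → cong₂ (λ u v → cfrob t b u v e w)
       (Linked.irrelevant ≻-irrelevant _ td) (Linked.irrelevant ≻-irrelevant _ bd) }))
  (sublists-↔ L _ λ b → sublists-↔ L _ λ t →
    ↔-trans (δ-↔ (length t) (length b) ×-↔ δ-↔ (Weight t b) N) (↔-sym Fin.*↔×))
  where
  L : List (CInt k)
  L = modes k (suc N)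
  T : Set
  T = Σ (List (CInt k)) λ b → b ⊆ L × Σ (List (CInt k)) λ t → t ⊆ L ×
        (length t ≡ length b × Weight t b ≡ N)
  value≤sum : (l : List (CInt k)) → All (λ x → value x ≤ sum (map value l)) l
  value≤sum []      = []
  value≤sum (x ∷ l) = m≤m+n (value x) _ ∷ All.map (λ p → ≤-trans p (m≤n+m _ (value x))) (value≤sum l)
  inModes : ∀ {l} → StrictDec l → sum (map value l) ≤ N → l ⊆ L
  inModes {l} d s≤N = sorted⇒⊆ ≻-irrefl ≻-trans (modes-decreasing k (suc N)) (Linked⇒AllPairs ≻-trans d)
    (All.map (λ {x} p → ∈-modes (suc N) (proj₂ x) (s≤s (≤-trans p s≤N))) (value≤sum l))
  to : CFrob k N → T
  to (cfrob t b td bd e w) =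
    b , inModes bd (≤-trans (m≤n+m _ _) (≤-trans (m≤n+m _ (length t)) (≤-reflexive w))) ,
    t , inModes td (≤-trans (m≤m+n _ _) (≤-trans (m≤n+m _ (length t)) (≤-reflexive w))) , e , w
  from : T → CFrob k N
  from (b , s , t , s′ , e , w) = cfrob t b
    (AllPairs⇒Linked (AllPairs-⊆ s′ (modes-decreasing k (suc N))))
    (AllPairs⇒Linked (AllPairs-⊆ s (modes-decreasing k (suc N)))) e w

rowSum : ∀ {k} → List (CInt k) → (ℕ → ℕ → ℕ) → ℕ
rowSum L φ = ∑ (sublists L) (λ l → φ (length l) (sum (map value l)))

-- Which of the colours occur with the value `ℓ` does not affect length and sum, only their number
-- `a` does; induction on the colours by Pascal's rule.
rowSum-chunk : ∀ {k} ℓ (cs : List (Fin k)) L φ → rowSum (map (ℓ ,_) cs ++ L) φ ≡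
  ∑ (upTo (suc (length cs))) (λ a → (length cs C a) * rowSum L (shift a (ℓ * a) φ))
rowSum-chunk ℓ []       L φ = begin
  rowSum L φ                                                  ≡⟨ ∑-cong (sublists L) (λ l → cong (λ z → φ (length l) (z + sum (map value l))) (sym (*-zeroʳ ℓ))) ⟩
  rowSum L (shift 0 (ℓ * 0) φ)                                ≡⟨ +-identityʳ _ ⟨
  (0 C 0) * rowSum L (shift 0 (ℓ * 0) φ)                      ≡⟨ ∑-single 0 (λ a → (0 C a) * rowSum L (shift a (ℓ * a) φ)) ⟨
  ∑ (upTo 1) (λ a → (0 C a) * rowSum L (shift a (ℓ * a) φ))   ∎
rowSum-chunk ℓ (c ∷ cs) L φ = begin
  rowSum ((ℓ , c) ∷ rest) φ
    ≡⟨ ∑-sublists-∷ (ℓ , c) rest _ ⟩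
  rowSum rest φ + rowSum rest (shift 1 ℓ φ)
    ≡⟨ cong₂ _+_ (rowSum-chunk ℓ cs L φ) (rowSum-chunk ℓ cs L (shift 1 ℓ φ)) ⟩
  ∑ (upTo (suc len)) (λ a → (len C a) * g a) + ∑ (upTo (suc len)) (λ a → (len C a) * rowSum L (shift a (ℓ * a) (shift 1 ℓ φ)))
    ≡⟨ cong (∑ (upTo (suc len)) (λ a → (len C a) * g a) +_) (∑-cong (upTo (suc len)) λ a → cong ((len C a) *_)
         (∑-cong (sublists L) λ l → cong (φ _) (next (sum (map value l)) a))) ⟩
  ∑ (upTo (suc len)) (λ a → (len C a) * g a) + ∑ (upTo (suc len)) (λ a → (len C a) * g (suc a))
    ≡⟨ ∑-binomial-suc len g ⟨
  ∑ (upTo (suc (suc len))) (λ a → (suc len C a) * g a) ∎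
  where
  rest : List (CInt _)
  rest = map (ℓ ,_) cs ++ L
  len : ℕ
  len = length cs
  g : ℕ → ℕ
  g a = rowSum L (shift a (ℓ * a) φ)
  next : ∀ s a → ℓ + (ℓ * a + s) ≡ ℓ * suc a + s
  next s a = trans (sym (+-assoc ℓ (ℓ * a) s)) (cong (_+ s) (sym (*-suc ℓ a)))

rowSum-modes : ∀ k K φ → rowSum (modes k K) φ ≡ downSum (k C_) k K φ
rowSum-modes k zero    φ = ∑-single [] _
rowSum-modes k (suc K) φ = begin
  rowSum (modes k (suc K)) φ
    ≡⟨ rowSum-chunk K (colours k) (modes k K) φ ⟩
  ∑ (upTo (suc (length (colours k)))) (λ a → (length (colours k) C a) * rowSum (modes k K) (shift a (K * a) φ))
    ≡⟨ cong (λ n → ∑ (upTo (suc n)) (λ a → (n C a) * rowSum (modes k K) (shift a (K * a) φ))) (length-colours k) ⟩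
  ∑ (upTo (suc k)) (λ a → (k C a) * rowSum (modes k K) (shift a (K * a) φ))
    ≡⟨ ∑-cong (upTo (suc k)) (λ a → cong ((k C a) *_) (rowSum-modes k K (shift a (K * a) φ))) ⟩
  downSum (k C_) k (suc K) φ ∎

-- Complementing the bottom row: one sum over words

δ-cancelˡ : ∀ k m n → δ (k + m) (k + n) ≡ δ m n
δ-cancelˡ zero    m n = refl
δ-cancelˡ (suc k) m n = δ-cancelˡ k m n

δ-≢ : ∀ {m n} → m ≢ n → δ m n ≡ 0
δ-≢ {zero}  {zero}  m≢n = contradiction refl m≢n
δ-≢ {zero}  {suc n} m≢n = refl
δ-≢ {suc m} {zero}  m≢n = refl
δ-≢ {suc m} {suc n} m≢n = δ-≢ (m≢n ∘ cong suc)

δ-*-cong : ∀ m n {p q} → (m ≡ n → p ≡ q) → δ m n * p ≡ δ m n * q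
δ-*-cong m n {p} {q} h with m ≟ n
... | yes m≡n = cong (δ m n *_) (h m≡n)
... | no m≢n  = trans (cong (_* p) (δ-≢ m≢n)) (sym (cong (_* q) (δ-≢ m≢n)))

∑-upTo-cong : ∀ n {f g : ℕ → ℕ} → (∀ a → a < n → f a ≡ g a) → ∑ (upTo n) f ≡ ∑ (upTo n) g
∑-upTo-cong zero    {f} {g} h = trans (∑-[] f) (sym (∑-[] g))
∑-upTo-cong (suc n) {f} {g} h = begin
  ∑ (upTo (suc n)) f   ≡⟨ ∑-upTo-last n f ⟩
  ∑ (upTo n) f + f n   ≡⟨ cong₂ _+_ (∑-upTo-cong n (λ a a<n → h a (m<n⇒m<1+n a<n))) (h n (n<1+n n)) ⟩
  ∑ (upTo n) g + g n   ≡⟨ ∑-upTo-last n g ⟨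
  ∑ (upTo (suc n)) g   ∎

∑-upTo-reverse : ∀ n (f : ℕ → ℕ) → ∑ (upTo (suc n)) f ≡ ∑ (upTo (suc n)) (λ a → f (n ∸ a))
∑-upTo-reverse zero    f = trans (∑-single 0 f) (sym (∑-single 0 (λ a → f (0 ∸ a))))
∑-upTo-reverse (suc n) f = begin
  ∑ (upTo (suc (suc n))) f                             ≡⟨ ∑-upTo-suc (suc n) f ⟩
  f 0 + ∑ (upTo (suc n)) (f ∘ suc)                     ≡⟨ cong (f 0 +_) (∑-upTo-reverse n (f ∘ suc)) ⟩
  f 0 + ∑ (upTo (suc n)) (λ a → f (suc (n ∸ a)))       ≡⟨ cong₂ (λ x y → f x + y) (sym (n∸n≡0 (suc n)))
                                                            (∑-upTo-cong (suc n) λ { a (s≤s a≤n) → cong f (sym (+-∸-assoc 1 a≤n)) }) ⟩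
  f (suc n ∸ suc n) + ∑ (upTo (suc n)) (λ a → f (suc n ∸ a))
                                                       ≡⟨ +-comm (f (suc n ∸ suc n)) _ ⟩
  ∑ (upTo (suc n)) (λ a → f (suc n ∸ a)) + f (suc n ∸ suc n)
                                                       ≡⟨ ∑-upTo-last (suc n) (λ a → f (suc n ∸ a)) ⟨
  ∑ (upTo (suc (suc n))) (λ a → f (suc n ∸ a))         ∎

-- The moment of a word of `n` letters `1` starting at `b`. Thus `k * positions 0 K` is the moment
-- of the vacuum, in which every position below `K` is full.
positions : ℕ → ℕ → ℕ
positions b zero    = 0
positions b (suc n) = b + positions (suc b) n

-- Replacing the letter a at position b + j by k ∸ a at position n ∸ 1 ∸ j.
downSum-complement : ∀ k n b ψ φ →
  (∀ c d s t → c + d ≡ k * n → t + (b + n) * d ≡ k * positions b n + s + d → ψ d s ≡ φ c t) →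
  downSum (k C_) k n ψ ≡ stateSum (k C_) k b n φ
downSum-complement k zero    b ψ φ h = trans
  (h 0 0 0 0 (sym (*-zeroʳ k)) (trans (*-zeroʳ (b + 0)) (sym (trans (+-identityʳ _) (trans (+-identityʳ _) (*-zeroʳ k))))))
  (sym (stateSum-zero (k C_) k b φ))
downSum-complement k (suc n) b ψ φ h = begin
  ∑ (upTo (suc k)) (λ a → (k C a) * downSum (k C_) k n (shift a (n * a) ψ))
    ≡⟨ ∑-upTo-reverse k _ ⟩
  ∑ (upTo (suc k)) (λ a → (k C (k ∸ a)) * downSum (k C_) k n (shift (k ∸ a) (n * (k ∸ a)) ψ))
    ≡⟨ ∑-upTo-cong (suc k) (λ { a (s≤s a≤k) → cong₂ _*_ (sym (nCk≡nC[n∸k] a≤k)) (rest a (k ∸ a) (m+[n∸m]≡n a≤k)) }) ⟩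
  ∑ (upTo (suc k)) (λ a → (k C a) * stateSum (k C_) k (suc b) n (shift a (b * a) φ))
    ≡⟨ stateSum-suc (k C_) k b n φ ⟨
  stateSum (k C_) k b (suc n) φ ∎
  where
  card : ∀ a a′ c d → a + c + (a′ + d) ≡ (a + a′) + (c + d)
  card = solve-∀
  -- The old and the new position of a letter add up to `b + n - 1`. Writing `b + n` on one side and
  -- an extra `d` on the other avoids the subtraction.
  left : ∀ a a′ b n d t → b * a + t + (b + suc n) * (a′ + d) ≡ b * (a + a′) + (n * a′ + a′) + (t + (suc b + n) * d)
  left = solve-∀
  right : ∀ k b p n a′ s d → b * k + (n * a′ + a′) + (k * p + s + d) ≡ k * (b + p) + (n * a′ + s) + (a′ + d)
  right = solve-∀
  rest : ∀ a a′ → a + a′ ≡ k →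
    downSum (k C_) k n (shift a′ (n * a′) ψ) ≡ stateSum (k C_) k (suc b) n (shift a (b * a) φ)
  rest a a′ a+a′≡k = downSum-complement k n (suc b) _ _ λ c d s t e₁ e₂ → h (a + c) (a′ + d) (n * a′ + s) (b * a + t)
    (trans (card a a′ c d) (trans (cong₂ _+_ a+a′≡k e₁) (sym (*-suc k n))))
    (trans (left a a′ b n d t) (trans (cong₂ (λ x y → b * x + (n * a′ + a′) + y) a+a′≡k e₂)
      (right k b (positions (suc b) n) n a′ s d)))

-- Position K + ℓ of a word stands for the entries ℓ of the top row, and position K ∸ 1 ∸ ℓ
-- for the entries ℓ that are missing from the bottom row.
frobSum≡stateSum : ∀ k N → let K = suc N in
  frobSum k N ≡ stateSum (k C_) k 0 (K + K) (λ c s → δ c (k * K) * δ s (k * positions 0 K + N))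
frobSum≡stateSum k N = begin
  frobSum k N
    ≡⟨ rowSum-modes k K (λ d s → rowSum (modes k K) (Q d s)) ⟩
  downSum (k C_) k K (λ d s → rowSum (modes k K) (Q d s))
    ≡⟨ downSum-complement k K 0 _ _ topRow ⟩
  stateSum (k C_) k 0 K (λ c s → stateSum (k C_) k K K (shift c s Φ))
    ≡⟨ stateSum-+ (k C_) k 0 K K Φ ⟨
  stateSum (k C_) k 0 (K + K) Φ ∎
  where
  K P : ℕ
  K = suc N
  P = positions 0 K
  Q : ℕ → ℕ → ℕ → ℕ → ℕ
  Q d s d′ s′ = δ d′ d * δ (d′ + (s′ + s)) N
  Φ : ℕ → ℕ → ℕ
  Φ c s = δ c (k * K) * δ s (k * P + N)
  regroup : ∀ x y z w → x + z + w + y ≡ x + (w + (y + z))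
  regroup = solve-∀
  topRow : ∀ c d s t → c + d ≡ k * K → t + K * d ≡ k * P + s + d →
    rowSum (modes k K) (Q d s) ≡ stateSum (k C_) k K K (shift c t Φ)
  topRow c d s t e₁ e₂ = begin
    rowSum (modes k K) (Q d s)               ≡⟨ rowSum-modes k K (Q d s) ⟩
    downSum (k C_) k K (Q d s)               ≡⟨ downSum≡stateSum (k C_) k K (Q d s) ⟩
    stateSum (k C_) k 0 K (Q d s)            ≡⟨ stateSum-cong (k C_) k 0 K balance ⟩
    stateSum (k C_) k 0 K (λ x y → shift c t Φ x (K * x + y))
                                             ≡⟨ stateSum-translate (k C_) k K K (shift c t Φ) ⟨
    stateSum (k C_) k K K (shift c t Φ)      ∎
    where
    balance : ∀ x y → Q d s x y ≡ shift c t Φ x (K * x + y)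
    balance x y = begin
      δ x d * δ (x + (y + s)) N
        ≡⟨ cong (δ x d *_) (sym (δ-cancelˡ (k * P) _ N)) ⟩
      δ x d * δ (k * P + (x + (y + s))) (k * P + N)
        -- The moments need to match only where the two rows have equal length; elsewhere the first
        -- delta is `0`.
        ≡⟨ δ-*-cong x d (λ { refl → cong (λ z → δ z (k * P + N)) (begin
             k * P + (x + (y + s))  ≡⟨ regroup (k * P) y s x ⟨
             k * P + s + x + y      ≡⟨ cong (_+ y) e₂ ⟨
             t + K * x + y          ≡⟨ +-assoc t (K * x) y ⟩
             t + (K * x + y)        ∎) }) ⟩
      δ x d * δ (t + (K * x + y)) (k * P + N)
        ≡⟨ cong (_* δ (t + (K * x + y)) (k * P + N)) (trans (sym (δ-cancelˡ c x d)) (cong (δ (c + x)) e₁)) ⟩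
      δ (c + x) (k * K) * δ (t + (K * x + y)) (k * P + N) ∎

-- Parity of occupation numbers

¬2∣1 : ¬ 2 ∣ 1
¬2∣1 = from-no (2 ∣? 1)

even⊎odd : ∀ a → (∃ λ k → a ≡ 2 * k) ⊎ (∃ λ k → a ≡ 1 + 2 * k)
even⊎odd zero    = inj₁ (0 , refl)
even⊎odd (suc a) with even⊎odd a
... | inj₁ (k , refl) = inj₂ (k , refl)
... | inj₂ (k , refl) = inj₁ (suc k , cong suc (sym (+-suc k (k + 0))))

double : Vec ℕ n → Vec ℕ n
double = Vec.map (2 *_)

total-double : (v : Vec ℕ n) → total (double v) ≡ 2 * total v
total-double []      = refl
total-double (a ∷ v) = trans (cong (2 * a +_) (total-double v)) (sym (*-distribˡ-+ 2 a (total v)))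

moment-double : ∀ b (v : Vec ℕ n) → moment b (double v) ≡ 2 * moment b v
moment-double b []      = refl
moment-double b (a ∷ v) = trans (cong (b * (2 * a) +_) (moment-double (suc b) v)) (distr b a _)
  where
  distr : ∀ b a s → b * (2 * a) + 2 * s ≡ 2 * (b * a + s)
  distr = solve-∀

weigh-double : ∀ w (v : Vec ℕ n) → weigh w (double v) ≡ weigh (w ∘ (2 *_)) v
weigh-double w []      = refl
weigh-double w (a ∷ v) = cong (w (2 * a) *_) (weigh-double w v)

-- The number of odd letters has the parity of the total.
oddLetters : ∀ w d → (∀ k → d ∣ w (1 + 2 * k)) → (v : Vec ℕ n) →
  (2 ∣ total v × ((∃ λ u → v ≡ double u) ⊎ d * d ∣ weigh w v)) ⊎ (2 ∣ 1 + total v × d ∣ weigh w v)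
oddLetters w d h []      = inj₁ (2 ∣0 , inj₁ ([] , refl))
oddLetters w d h (a ∷ v) with even⊎odd a | oddLetters w d h v
... | inj₁ (k , refl) | inj₁ (e , inj₁ (u , refl)) = inj₁ (∣m∣n⇒∣m+n (m∣m*n k) e , inj₁ (k ∷ u , refl))
... | inj₁ (k , refl) | inj₁ (e , inj₂ q)          = inj₁ (∣m∣n⇒∣m+n (m∣m*n k) e , inj₂ (∣n⇒∣m*n (w a) q))
... | inj₁ (k , refl) | inj₂ (o , q)               =
  inj₂ (subst (2 ∣_) (+-suc (2 * k) (total v)) (∣m∣n⇒∣m+n (m∣m*n k) o) , ∣n⇒∣m*n (w a) q)
... | inj₂ (k , refl) | inj₁ (e , _)               =
  inj₂ (∣m∣n⇒∣m+n (divides (suc k) (comm k)) e , ∣m⇒∣m*n (weigh w v) (h k))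
  where
  comm : ∀ k → 2 + 2 * k ≡ suc k * 2
  comm = solve-∀
... | inj₂ (k , refl) | inj₂ (o , q)               =
  inj₁ (subst (2 ∣_) (+-suc (2 * k) (total v)) (∣m∣n⇒∣m+n (m∣m*n k) o) , inj₂ (*-pres-∣ (h k) q))

evenTotal : ∀ w d → (∀ k → d ∣ w (1 + 2 * k)) → (v : Vec ℕ n) → 2 ∣ total v →
  (∃ λ u → v ≡ double u) ⊎ d * d ∣ weigh w v
evenTotal w d h v e with oddLetters w d h v
... | inj₁ (_ , r) = r
... | inj₂ (o , _) = contradiction (∣m+n∣m⇒∣n (subst (2 ∣_) (+-comm 1 (total v)) o) e) ¬2∣1

-- For `1 ≤ a ≤ 8` the 2-adic valuation of `8 C a` is `3` minus that of `a`. This and the next two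
-- lemmas check the cases needed; beyond `8` the binomial is `0`.
8C[1+2k] : ∀ k → 8 ∣ 8 C (1 + 2 * k)
8C[1+2k] 0 = from-yes (8 ∣? 8 C 1)
8C[1+2k] 1 = from-yes (8 ∣? 8 C 3)
8C[1+2k] 2 = from-yes (8 ∣? 8 C 5)
8C[1+2k] 3 = from-yes (8 ∣? 8 C 7)
8C[1+2k] (suc (suc (suc (suc k)))) = subst (8 ∣_) (sym (k>n⇒nCk≡0 (m+n≤o⇒m≤o 9 {2 * k} (≤-reflexive (big k))))) (8 ∣0)
  where
  big : ∀ k → 9 + 2 * k ≡ 1 + 2 * (4 + k)
  big = solve-∀

8C[2+4k] : ∀ k → 4 ∣ 8 C (2 * (1 + 2 * k))
8C[2+4k] 0 = from-yes (4 ∣? 8 C 2)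
8C[2+4k] 1 = from-yes (4 ∣? 8 C 6)
8C[2+4k] (suc (suc k)) = subst (4 ∣_) (sym (k>n⇒nCk≡0 (m+n≤o⇒m≤o 9 {1 + 4 * k} (≤-reflexive (big k))))) (4 ∣0)
  where
  big : ∀ k → 9 + (1 + 4 * k) ≡ 2 * (1 + 2 * (2 + k))
  big = solve-∀

8C[4+8k] : ∀ k → 2 ∣ 8 C (2 * (2 * (1 + 2 * k)))
8C[4+8k] 0 = from-yes (2 ∣? 8 C 4)
8C[4+8k] (suc k) = subst (2 ∣_) (sym (k>n⇒nCk≡0 (m+n≤o⇒m≤o 9 {3 + 8 * k} (≤-reflexive (big k))))) (2 ∣0)
  where
  big : ∀ k → 9 + (3 + 8 * k) ≡ 2 * (2 * (1 + 2 * (1 + k)))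
  big = solve-∀

evenTotal₈ : (v : Vec ℕ n) → 2 ∣ total v → (∃ λ u → v ≡ double u) ⊎ 64 ∣ weigh (8 C_) v
evenTotal₈ = evenTotal (8 C_) 8 8C[1+2k]

-- A word with even letters only would have an even moment, so there are at least two odd letters.
odd-term : (v : Vec ℕ n) → 2 ∣ total v → ¬ 2 ∣ moment 0 v → 64 ∣ weigh (8 C_) v
odd-term v e o with evenTotal₈ v e
... | inj₁ (u , refl) = contradiction (divides (moment 0 u) (trans (moment-double 0 u) (*-comm 2 (moment 0 u)))) o
... | inj₂ q          = q

-- Two rounds of halving. Since `4` divides the total, the halved word has an even total again, and
-- a pair of odd letters in it contributes `4 * 4`.
twiceOdd-term : (v : Vec ℕ n) → 4 ∣ total v → ¬ 4 ∣ moment 0 v → 16 ∣ weigh (8 C_) v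
twiceOdd-term v e o with evenTotal₈ v (∣-trans (divides 2 refl) e)
... | inj₂ q          = ∣-trans (divides 4 refl) q
... | inj₁ (u , refl) with evenTotal ((8 C_) ∘ (2 *_)) 4 8C[2+4k] u (*-cancelˡ-∣ 2 (subst (4 ∣_) (total-double u) e))
...   | inj₂ q          = subst (16 ∣_) (sym (weigh-double (8 C_) u)) q
...   | inj₁ (t , refl) = contradiction (subst (4 ∣_) (sym (quadruple t)) (m∣m*n (moment 0 t))) o
  where
  quadruple : (t : Vec ℕ n) → moment 0 (double (double t)) ≡ 4 * moment 0 t
  quadruple t = trans (moment-double 0 (double t)) (trans (cong (2 *_) (moment-double 0 t)) (sym (*-assoc 2 2 (moment 0 t))))

-- A third round of halving, where a pair of odd letters contributes `2 * 2`.
fourTimesOdd-term : (v : Vec ℕ n) → 8 ∣ total v → ¬ 8 ∣ moment 0 v → 4 ∣ weigh (8 C_) v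
fourTimesOdd-term v e o with evenTotal₈ v (∣-trans (divides 4 refl) e)
... | inj₂ q          = ∣-trans (divides 16 refl) q
... | inj₁ (u , refl) with *-cancelˡ-∣ 2 (subst (8 ∣_) (total-double u) e)
...   | e′ with evenTotal ((8 C_) ∘ (2 *_)) 4 8C[2+4k] u (∣-trans (divides 2 refl) e′)
...     | inj₂ q          = ∣-trans (divides 4 refl) (subst (16 ∣_) (sym (weigh-double (8 C_) u)) q)
...     | inj₁ (t , refl) with evenTotal ((8 C_) ∘ (2 *_) ∘ (2 *_)) 2 8C[4+8k] t
                                 (*-cancelˡ-∣ 2 (subst (4 ∣_) (total-double t) e′))
...       | inj₂ q          = subst (4 ∣_) (sym (trans (weigh-double (8 C_) (double t)) (weigh-double ((8 C_) ∘ (2 *_)) t))) q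
...       | inj₁ (s , refl) = contradiction (subst (8 ∣_) (sym (octuple s)) (m∣m*n (moment 0 s))) o
  where
  octuple : (s : Vec ℕ n) → moment 0 (double (double (double s))) ≡ 8 * moment 0 s
  octuple s = trans (moment-double 0 (double (double s))) (trans (cong (2 *_) (trans (moment-double 0 (double s))
    (cong (2 *_) (moment-double 0 s)))) (assoc (moment 0 s)))
    where
    assoc : ∀ x → 2 * (2 * (2 * x)) ≡ 8 * x
    assoc = solve-∀

δ*δ-∣ : ∀ {d w} a b c e → (a ≡ b → c ≡ e → d ∣ w) → d ∣ w * (δ a b * δ c e)
δ*δ-∣ {d} {w} a b c e h with a ≟ b | c ≟ e
... | yes p | yes q = ∣m⇒∣m*n _ (h p q)
... | no p  | _     = ∣n⇒∣m*n w (∣m⇒∣m*n (δ c e) (subst (d ∣_) (sym (δ-≢ p)) (d ∣0)))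
... | yes _ | no q  = ∣n⇒∣m*n w (∣n⇒∣m*n (δ a b) (subst (d ∣_) (sym (δ-≢ q)) (d ∣0)))

-- Reduction modulo 64 to words with two marked letters

-- unmarked a ≡ 8 C a mod 4 if 4 ∣ a, and 28 * marked a ≡ 8 C a if a is twice an odd number.
unmarked : ℕ → ℕ
unmarked 0 = 1
unmarked 4 = 2
unmarked 8 = 1
unmarked _ = 0

marked : ℕ → ℕ
marked 2 = 1
marked 6 = 1
marked _ = 0

-- The coefficient of `x^s` in the product of the factors `unmarked a + marked a * x`. No letter has
-- both weights nonzero, so a nonzero value means exactly `s` marked letters.
marks : ℕ → Vec ℕ n → ℕ
marks zero    []      = 1
marks (suc s) []      = 0
marks zero    (a ∷ v) = unmarked a * marks zero v
marks (suc s) (a ∷ v) = unmarked a * marks (suc s) v + marked a * marks s v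

-- A congruence with a natural quotient, so that `x` is at least `y` and neither subtraction nor
-- integers are needed; for example `8 C 4 = 70 = 2 + 4 * 17`.
infix 4 _≡_mod⁺_
record _≡_mod⁺_ (x y d : ℕ) : Set where
  constructor _,_
  field
    quotient : ℕ
    equality : x ≡ y + d * quotient

-- The letter classified is `2 * a`: divisible by `4`, or twice an odd number. The constant `28` is
-- the common value of `8 C 2` and `8 C 6`.
data Letter (a : ℕ) : Set where
  plain : ∀ b → a ≡ 2 * b → 8 C (2 * a) ≡ unmarked (2 * a) mod⁺ 4 → marked (2 * a) ≡ 0 → Letter a
  mark  : 2 ∣ 1 + a → 8 C (2 * a) ≡ 28 * marked (2 * a) → unmarked (2 * a) ≡ 0 → Letter a

letter : ∀ a → Letter a
letter 0 = plain 0 refl (0 , refl) refl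
letter 1 = mark (divides 1 refl) refl refl
letter 2 = plain 1 refl (17 , refl) refl
letter 3 = mark (divides 2 refl) refl refl
letter 4 = plain 2 refl (0 , refl) refl
letter (suc (suc (suc (suc (suc a))))) with even⊎odd (5 + a)
... | inj₁ (b , a≡2b) = plain b a≡2b (0 , trans C≡0 (sym (trans (+-identityʳ _) unmarked≡0))) marked≡0
  where
  big : ∀ a → 9 + (1 + 2 * a) ≡ 2 * (5 + a)
  big = solve-∀
  C≡0        = subst (λ x → 8 C x ≡ 0) (big a) (k>n⇒nCk≡0 (m≤m+n 9 (1 + 2 * a)))
  unmarked≡0 = subst (λ x → unmarked x ≡ 0) (big a) refl
  marked≡0   = subst (λ x → marked x ≡ 0) (big a) refl
... | inj₂ (b , a≡1+2b) = mark (divides (suc b) (trans (cong suc a≡1+2b) (comm b)))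
  (trans C≡0 (sym (cong (28 *_) marked≡0))) unmarked≡0
  where
  big : ∀ a → 9 + (1 + 2 * a) ≡ 2 * (5 + a)
  big = solve-∀
  comm : ∀ k → 2 + 2 * k ≡ suc k * 2
  comm = solve-∀
  C≡0        = subst (λ x → 8 C x ≡ 0) (big a) (k>n⇒nCk≡0 (m≤m+n 9 (1 + 2 * a)))
  unmarked≡0 = subst (λ x → unmarked x ≡ 0) (big a) refl
  marked≡0   = subst (λ x → marked x ≡ 0) (big a) refl

odd-letter : ∀ k → unmarked (1 + 2 * k) ≡ 0 × marked (1 + 2 * k) ≡ 0
odd-letter 0 = refl , refl
odd-letter 1 = refl , refl
odd-letter 2 = refl , refl
odd-letter 3 = refl , refl
odd-letter (suc (suc (suc (suc k)))) = subst (λ a → unmarked a ≡ 0 × marked a ≡ 0) (big k) (refl , refl)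
  where
  big : ∀ k → 9 + 2 * k ≡ 1 + 2 * (4 + k)
  big = solve-∀

double⊎marks≡0 : (v : Vec ℕ n) → (∃ λ u → v ≡ double u) ⊎ (∀ s → marks s v ≡ 0)
double⊎marks≡0 []      = inj₁ ([] , refl)
double⊎marks≡0 (a ∷ v) with even⊎odd a | double⊎marks≡0 v
... | inj₁ (k , refl) | inj₁ (u , refl) = inj₁ (k ∷ u , refl)
... | inj₁ _          | inj₂ z          = inj₂ λ
  { zero    → trans (cong (unmarked a *_) (z 0)) (*-zeroʳ (unmarked a))
  ; (suc s) → cong₂ _+_ (trans (cong (unmarked a *_) (z (suc s))) (*-zeroʳ (unmarked a)))
                        (trans (cong (marked a *_) (z s)) (*-zeroʳ (marked a))) }
... | inj₂ (k , refl) | _               = inj₂ λ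
  { zero    → cong (_* marks zero v) (proj₁ (odd-letter k))
  ; (suc s) → cong₂ _+_ (cong (_* marks (suc s) v) (proj₁ (odd-letter k)))
                        (cong (_* marks s v) (proj₂ (odd-letter k))) }

-- The three cases: no letter ≡ 2 mod 4 in double u, an odd number of them, a positive even number.
data Marking (u : Vec ℕ n) : Set where
  none : (∃ λ t → u ≡ double t) → weigh (8 C_) (double u) ≡ marks 0 (double u) mod⁺ 4 → Marking u
  odd  : 2 ∣ 1 + total u → weigh (8 C_) (double u) ≡ 28 * marks 1 (double u) mod⁺ 16 → Marking u
  even : 2 ∣ total u → marks 0 (double u) ≡ 0 →
         weigh (8 C_) (double u) ≡ 784 * marks 2 (double u) mod⁺ 64 → Marking u

private
  plain-none : ∀ {w W x y} → w ≡ x mod⁺ 4 → W ≡ y mod⁺ 4 → w * W ≡ x * y mod⁺ 4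
  plain-none {x = x} {y} (l , refl) (q , refl) = (x * q + l * y + 4 * l * q) , expand x l y q
    where
    expand : ∀ x l y q → (x + 4 * l) * (y + 4 * q) ≡ x * y + 4 * (x * q + l * y + 4 * l * q)
    expand = solve-∀

  plain-odd : ∀ {w W x m y y′} → w ≡ x mod⁺ 4 → m ≡ 0 → W ≡ 28 * y mod⁺ 16 →
    w * W ≡ 28 * (x * y + m * y′) mod⁺ 16
  plain-odd {x = x} {y = y} (l , refl) refl (q , refl) = (x * q + 7 * l * y + 4 * l * q) , expand x l y q
    where
    expand : ∀ x l y q → (x + 4 * l) * (28 * y + 16 * q) ≡ 28 * (x * y + 0) + 16 * (x * q + 7 * l * y + 4 * l * q)
    expand = solve-∀

  plain-even : ∀ {w W x m y y′} → w ≡ x mod⁺ 4 → m ≡ 0 → W ≡ 784 * y mod⁺ 64 →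
    w * W ≡ 784 * (x * y + m * y′) mod⁺ 64
  plain-even {x = x} {y = y} (l , refl) refl (q , refl) = (x * q + 49 * l * y + 4 * l * q) , expand x l y q
    where
    expand : ∀ x l y q → (x + 4 * l) * (784 * y + 64 * q) ≡ 784 * (x * y + 0) + 64 * (x * q + 49 * l * y + 4 * l * q)
    expand = solve-∀

  -- A marked letter brings the factor `28 = 4 * 7`, which lifts a congruence mod `4` to one mod
  -- `16`. In the same way `mark-odd` passes from `16` to `64`, with `784 = 28 * 28`.
  mark-none : ∀ {w W x m y y′} → w ≡ 28 * m → x ≡ 0 → W ≡ y′ mod⁺ 4 → w * W ≡ 28 * (x * y + m * y′) mod⁺ 16
  mark-none {m = m} {y′ = y} refl refl (q , refl) = (7 * m * q) , expand m y q
    where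
    expand : ∀ x y q → 28 * x * (y + 4 * q) ≡ 28 * (x * y) + 16 * (7 * x * q)
    expand = solve-∀

  mark-odd : ∀ {w W x m y y′} → w ≡ 28 * m → x ≡ 0 → W ≡ 28 * y′ mod⁺ 16 →
    w * W ≡ 784 * (x * y + m * y′) mod⁺ 64
  mark-odd {m = m} {y′ = y} refl refl (q , refl) = (7 * m * q) , expand m y q
    where
    expand : ∀ x y q → 28 * x * (28 * y + 16 * q) ≡ 784 * (x * y) + 64 * (7 * x * q)
    expand = solve-∀

  -- At least three marked letters: both sides are `0` mod `16`, since `784` and `64` are multiples
  -- of `16` and no count of exactly one mark remains.
  mark-even : ∀ {w W x m y y′ y″} → w ≡ 28 * m → x ≡ 0 → y′ ≡ 0 → W ≡ 784 * y″ mod⁺ 64 →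
    w * W ≡ 28 * (x * y + m * y′) mod⁺ 16
  mark-even {m = m} {y″ = y} refl refl refl (q , refl) = (m * (1372 * y + 112 * q)) , expand m y q
    where
    expand : ∀ x y q → 28 * x * (784 * y + 64 * q) ≡ 28 * (x * 0) + 16 * (x * (1372 * y + 112 * q))
    expand = solve-∀

  2∣a+1+t : ∀ a {t} → 2 ∣ a → 2 ∣ 1 + t → 2 ∣ 1 + (a + t)
  2∣a+1+t a {t} p q = subst (2 ∣_) (+-suc a t) (∣m∣n⇒∣m+n p q)

marking : (u : Vec ℕ n) → Marking u
marking []      = none ([] , refl) (0 , refl)
marking (a ∷ u) with letter a | marking u
... | plain b refl wa ma | none (t , refl) w = none (b ∷ t , refl) (plain-none wa w)
... | plain b refl wa ma | odd o w           = odd (2∣a+1+t (2 * b) (m∣m*n b) o) (plain-odd {y = marks 1 (double u)} wa ma w)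
... | plain b refl wa ma | even e z w        = even (∣m∣n⇒∣m+n (m∣m*n b) e)
  (trans (cong (unmarked (2 * a) *_) z) (*-zeroʳ (unmarked (2 * a)))) (plain-even {y = marks 2 (double u)} wa ma w)
... | mark o wa ua | none (t , refl) w =
  odd (∣m∣n⇒∣m+n o (subst (2 ∣_) (sym (total-double t)) (m∣m*n (total t)))) (mark-none {m = marked (2 * a)} wa ua w)
... | mark o wa ua | odd o′ w          = even
  (∣m+n∣m⇒∣n (subst (2 ∣_) (regroup a (total u)) (∣m∣n⇒∣m+n o o′)) (divides 1 refl))
  (cong (_* marks 0 (double u)) ua) (mark-odd {m = marked (2 * a)} {y′ = marks 1 (double u)} wa ua w)
  where
  regroup : ∀ a t → 1 + a + (1 + t) ≡ 2 + (a + t)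
  regroup = solve-∀
... | mark o wa ua | even e z w        = odd (∣m∣n⇒∣m+n o e) (mark-even {m = marked (2 * a)} {y″ = marks 2 (double u)} wa ua z w)

-- The moment rules out that all letters are divisible by `4`, and the total rules out an odd number
-- of letters `2` mod `4`. If odd letters occur, `marks` vanishes and `64` divides the weight.
weigh≡784*marks : (v : Vec ℕ n) → 4 ∣ total v → ¬ 4 ∣ moment 0 v → weigh (8 C_) v ≡ 784 * marks 2 v mod⁺ 64
weigh≡784*marks v e o = byDouble (double⊎marks≡0 v)
  where
  fromMarking : ∀ u → v ≡ double u → Marking u → weigh (8 C_) v ≡ 784 * marks 2 v mod⁺ 64
  fromMarking u refl (even _ _ w)      = w
  fromMarking u refl (none (t , refl) _) = contradiction
    (subst (4 ∣_) (sym (trans (moment-double 0 (double t)) (trans (cong (2 *_) (moment-double 0 t)) (sym (*-assoc 2 2 (moment 0 t))))))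
      (m∣m*n (moment 0 t))) o
  fromMarking u refl (odd d _)         = contradiction
    (∣m+n∣m⇒∣n {2} {total u} {1} (subst (2 ∣_) (+-comm 1 (total u)) d) (*-cancelˡ-∣ 2 (subst (4 ∣_) (total-double u) e))) ¬2∣1
  byDouble : (∃ λ u → v ≡ double u) ⊎ (∀ s → marks s v ≡ 0) → weigh (8 C_) v ≡ 784 * marks 2 v mod⁺ 64
  byDouble (inj₁ (u , eq)) = fromMarking u eq (marking u)
  byDouble (inj₂ z) with evenTotal₈ v (∣-trans (divides 2 refl) e)
  ... | inj₁ (u , eq)      = fromMarking u eq (marking u)
  ... | inj₂ (divides k w) = k , trans w (trans (*-comm k 64) (cong (λ x → 784 * x + 64 * k) (sym (z 2))))

-- Pairs of Maya diagrams and their hooks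

bit : Bool → ℕ
bit false = 0
bit true  = 1

-- The weights `1`, `2`, `1` of the unmarked letters `0`, `4`, `8` count the pairs of bits with sum
-- `0`, `1`, `2`.
Pair : Set
Pair = Bool × Bool

pairs : List Pair
pairs = (false , false) ∷ (false , true) ∷ (true , false) ∷ (true , true) ∷ []

size : Pair → ℕ
size (c , d) = bit c + bit d

card : Vec Pair n → ℕ
card p = total (Vec.map size p)

mom : ℕ → Vec Pair n → ℕ
mom b p = moment b (Vec.map size p)

-- Only the second diagram is inspected. Beyond the window both values are `0`, so hooks that leave
-- it are not counted.
occupied vacant : Vec Pair n → ℕ → ℕ
occupied []            j       = 0
occupied ((_ , d) ∷ p) zero    = bit d
occupied (_ ∷ p)       (suc j) = occupied p j
vacant []            j       = 0
vacant ((_ , d) ∷ p) zero    = bit (not d)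
vacant (_ ∷ p)       (suc j) = vacant p j

upHooks downHooks : ℕ → Vec Pair n → ℕ
upHooks   {n} h p = ∑ (upTo n) (λ j → occupied p j * vacant p (j + h))
downHooks {n} h p = ∑ (upTo n) (λ j → vacant p j * occupied p (j + h))

vacant-outside : (p : Vec Pair n) → ∀ k → n ≤ k → vacant p k ≡ 0
vacant-outside []      k       _         = refl
vacant-outside (_ ∷ p) (suc k) (s≤s n≤k) = vacant-outside p k n≤k

occupied-outside : (p : Vec Pair n) → ∀ k → n ≤ k → occupied p k ≡ 0
occupied-outside []      k       _         = refl
occupied-outside (_ ∷ p) (suc k) (s≤s n≤k) = occupied-outside p k n≤k

upHooks-outside : (p : Vec Pair n) → ∀ h → n ≤ h → upHooks h p ≡ 0
upHooks-outside {n} p h n≤h = trans (∑-cong (upTo n) λ j →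
  trans (cong (occupied p j *_) (vacant-outside p (j + h) (≤-trans n≤h (m≤n+m h j)))) (*-zeroʳ (occupied p j)))
  (∑-zero (upTo n))

upHooks-∷ : ∀ x (p : Vec Pair n) h → upHooks (suc h) (x ∷ p) ≡ bit (proj₂ x) * vacant p h + upHooks (suc h) p
upHooks-∷ {n} x p h = ∑-upTo-suc n (λ j → occupied (x ∷ p) j * vacant (x ∷ p) (j + suc h))

opaque
  unfolding ∑

  pairs-letters : (f : Pair → ℕ) →
    ∑ pairs f ≡ f (false , false) + (f (false , true) + (f (true , false) + (f (true , true) + 0)))
  pairs-letters f = refl

  unmarked-letters : (f : ℕ → ℕ) → ∑ (upTo 9) (λ a → unmarked a * f a) ≡ f 0 + (2 * f 4 + f 8)
  unmarked-letters f = collect (f 0) (f 4) (f 8)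
    where
    collect : ∀ x y z → 1 * x + (2 * y + (1 * z + 0)) ≡ x + (2 * y + z)
    collect = solve-∀

  marked-letters : (f : ℕ → ℕ) → ∑ (upTo 9) (λ a → marked a * f a) ≡ f 2 + f 6
  marked-letters f = collect (f 2) (f 6)
    where
    collect : ∀ x y → 1 * x + (1 * y + 0) ≡ x + y
    collect = solve-∀

-- In terms of pairs of bits, an unmarked letter is 4 (c + d).  A marked letter 2 or 6 is 4 (c + 1) - 2
-- where a particle of the second diagram leaves (d = 1) and 4 (c + 0) + 2 where it arrives (d = 0).
markedSum : ℕ → ℕ → (n : ℕ) → (ℕ → ℕ → ℕ) → ℕ
markedSum s b n φ = ∑ (words (upTo 9) n) (λ v → marks s v * φ (total v) (moment b v))

-- The index is the number of marks still to be read. With one left, the arrival at `b + k` adds `2`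
-- to the total; with two, the departure cancels this `2` and only `2` times the distance remains in
-- the moment.
pairSum₀ pairSum₁ pairSum₂ : ℕ → (n : ℕ) → (ℕ → ℕ → ℕ) → ℕ
pairSum₀ b n φ = ∑ (words pairs n) λ p → φ (4 * card p) (4 * mom b p)
pairSum₁ b n φ = ∑ (words pairs n) λ p → ∑ (upTo n) λ k →
  vacant p k * φ (4 * card p + 2) (4 * mom b p + 2 * (b + k))
pairSum₂ b n φ = ∑ (words pairs n) λ p → ∑ (upTo n) λ h →
  upHooks (suc h) p * φ (4 * card p) (4 * mom b p + 2 * suc h)

module _ (b n : ℕ) (φ : ℕ → ℕ → ℕ) where

  private
    N : List (Vec ℕ n)
    N = words (upTo 9) n
    P : List (Vec Pair n)
    P = words pairs n
    φ⟨_⟩ : ℕ → ℕ → ℕ → ℕ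
    φ⟨ a ⟩ = shift a (b * a) φ

  -- Marked sums and pair sums are compared through a common recursion in the first letter: `f`
  -- collects the words whose head is unmarked, `g` those whose head uses up a mark.
  markedSum-zero-suc : let f = λ a → markedSum 0 (suc b) n φ⟨ a ⟩ in
    markedSum 0 b (suc n) φ ≡ f 0 + (2 * f 4 + f 8)
  markedSum-zero-suc = begin
    markedSum 0 b (suc n) φ
      ≡⟨ ∑-words-suc n (upTo 9) _ ⟩
    ∑ (upTo 9) (λ a → ∑ N (λ v → unmarked a * marks 0 v * φ⟨ a ⟩ (total v) (moment (suc b) v)))
      ≡⟨ ∑-cong (upTo 9) (λ a → trans (∑-cong N (λ v → *-assoc (unmarked a) (marks 0 v) _)) (∑-*ˡ N (unmarked a) _)) ⟩
    ∑ (upTo 9) (λ a → unmarked a * markedSum 0 (suc b) n φ⟨ a ⟩)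
      ≡⟨ unmarked-letters _ ⟩
    _ ∎

  markedSum-suc-suc : ∀ s → let f = λ a → markedSum (suc s) (suc b) n φ⟨ a ⟩; g = λ a → markedSum s (suc b) n φ⟨ a ⟩ in
    markedSum (suc s) b (suc n) φ ≡ f 0 + (2 * f 4 + f 8) + (g 2 + g 6)
  markedSum-suc-suc s = begin
    markedSum (suc s) b (suc n) φ
      ≡⟨ ∑-words-suc n (upTo 9) _ ⟩
    ∑ (upTo 9) (λ a → ∑ N (λ v → (unmarked a * marks (suc s) v + marked a * marks s v) * ψ a v))
      ≡⟨ ∑-cong (upTo 9) (λ a → trans (∑-cong N (λ v → distr (unmarked a) (marks (suc s) v) (marked a) (marks s v) (ψ a v)))
           (trans (∑-+ N _ _) (cong₂ _+_ (∑-*ˡ N (unmarked a) _) (∑-*ˡ N (marked a) _)))) ⟩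
    ∑ (upTo 9) (λ a → unmarked a * markedSum (suc s) (suc b) n φ⟨ a ⟩ + marked a * markedSum s (suc b) n φ⟨ a ⟩)
      ≡⟨ trans (∑-+ (upTo 9) _ _) (cong₂ _+_ (unmarked-letters _) (marked-letters _)) ⟩
    _ ∎
    where
    ψ : ℕ → Vec ℕ n → ℕ
    ψ a v = φ⟨ a ⟩ (total v) (moment (suc b) v)
    distr : ∀ u x m y z → (u * x + m * y) * z ≡ u * (x * z) + m * (y * z)
    distr = solve-∀

  pairSum₀-suc : let f = λ a → pairSum₀ (suc b) n φ⟨ a ⟩ in pairSum₀ b (suc n) φ ≡ f 0 + (2 * f 4 + f 8)
  pairSum₀-suc = begin
    pairSum₀ b (suc n) φ
      ≡⟨ ∑-words-suc n pairs _ ⟩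
    ∑ pairs (λ x → ∑ P (λ p → φ (4 * (size x + card p)) (4 * (b * size x + mom (suc b) p))))
      ≡⟨ ∑-cong pairs (λ x → ∑-cong P (λ p → cong₂ φ (*-distribˡ-+ 4 (size x) (card p)) (moments (size x) b (mom (suc b) p)))) ⟩
    ∑ pairs (λ x → f (4 * size x))
      ≡⟨ pairs-letters _ ⟩
    f 0 + (f 4 + (f 4 + (f 8 + 0)))
      ≡⟨ collect (f 0) (f 4) (f 8) ⟩
    f 0 + (2 * f 4 + f 8) ∎
    where
    f : ℕ → ℕ
    f a = pairSum₀ (suc b) n φ⟨ a ⟩
    moments : ∀ c b m → 4 * (b * c + m) ≡ b * (4 * c) + 4 * m
    moments = solve-∀
    collect : ∀ x y z → x + (y + (y + (z + 0))) ≡ x + (2 * y + z)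
    collect = solve-∀

  pairSum₁-suc : let f = λ a → pairSum₁ (suc b) n φ⟨ a ⟩; g = λ a → pairSum₀ (suc b) n φ⟨ a ⟩ in
    pairSum₁ b (suc n) φ ≡ f 0 + (2 * f 4 + f 8) + (g 2 + g 6)
  pairSum₁-suc = begin
    pairSum₁ b (suc n) φ
      ≡⟨ ∑-words-suc n pairs _ ⟩
    ∑ pairs (λ x → ∑ P (λ p → ∑ (upTo (suc n)) (λ k → vacant (x ∷ p) k * ψ x p k)))
      -- The arrival is either at the head, leaving no mark for the tail, or inside the tail.
      ≡⟨ ∑-cong pairs (λ x → trans (∑-cong P (λ p → trans (∑-upTo-suc n _) (cong₂ _+_ (headVacant x p)
           (∑-cong (upTo n) (λ k → cong (vacant p k *_) (cong₂ φ (cards (size x) (card p)) (moments (size x) b (mom (suc b) p) k))))))) 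
           (trans (∑-+ P _ _) (cong (_+ f (4 * size x)) (∑-*ˡ P (bit (not (proj₂ x))) _)))) ⟩
    ∑ pairs (λ x → bit (not (proj₂ x)) * g (4 * bit (proj₁ x) + 2) + f (4 * size x))
      ≡⟨ pairs-letters _ ⟩
    _ ≡⟨ collect (f 0) (f 4) (f 8) (g 2) (g 6) ⟩
    f 0 + (2 * f 4 + f 8) + (g 2 + g 6) ∎
    where
    f g : ℕ → ℕ
    f a = pairSum₁ (suc b) n φ⟨ a ⟩
    g a = pairSum₀ (suc b) n φ⟨ a ⟩
    ψ : Pair → Vec Pair n → ℕ → ℕ
    ψ x p k = φ (4 * (size x + card p) + 2) (4 * (b * size x + mom (suc b) p) + 2 * (b + k))
    cards : ∀ c t → 4 * (c + t) + 2 ≡ 4 * c + (4 * t + 2)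
    cards = solve-∀
    moments : ∀ c b m k → 4 * (b * c + m) + 2 * (b + suc k) ≡ b * (4 * c) + (4 * m + 2 * (suc b + k))
    moments = solve-∀
    headVacant : ∀ x p → vacant (x ∷ p) 0 * ψ x p 0 ≡
      bit (not (proj₂ x)) * φ⟨ 4 * bit (proj₁ x) + 2 ⟩ (4 * card p) (4 * mom (suc b) p)
    headVacant (c , true)  p = refl
    headVacant (c , false) p = cong (1 *_) (cong₂ φ (cards′ (bit c) (card p)) (moments′ (bit c) b (mom (suc b) p)))
      where
      cards′ : ∀ c t → 4 * (c + 0 + t) + 2 ≡ 4 * c + 2 + 4 * t
      cards′ = solve-∀
      moments′ : ∀ c b m → 4 * (b * (c + 0) + m) + 2 * (b + 0) ≡ b * (4 * c + 2) + 4 * m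
      moments′ = solve-∀
    collect : ∀ x y z u w → (1 * u + x) + (y + ((1 * w + y) + (z + 0))) ≡ x + (2 * y + z) + (u + w)
    collect = solve-∀

  pairSum₂-suc : let f = λ a → pairSum₂ (suc b) n φ⟨ a ⟩; g = λ a → pairSum₁ (suc b) n φ⟨ a ⟩ in
    pairSum₂ b (suc n) φ ≡ f 0 + (2 * f 4 + f 8) + (g 2 + g 6)
  pairSum₂-suc = begin
    pairSum₂ b (suc n) φ
      ≡⟨ ∑-words-suc n pairs _ ⟩
    ∑ pairs (λ x → ∑ P (λ p → ∑ (upTo (suc n)) (λ h → upHooks (suc h) (x ∷ p) * ψ x p h)))
      ≡⟨ ∑-cong pairs (λ x → trans (∑-cong P (λ p → hooks x p)) (trans (∑-+ P _ _)
           (cong (_+ f (4 * size x)) (∑-*ˡ P (bit (proj₂ x)) _)))) ⟩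
    ∑ pairs (λ x → bit (proj₂ x) * g (4 * bit (proj₁ x) + 2) + f (4 * size x))
      ≡⟨ pairs-letters _ ⟩
    _ ≡⟨ collect (f 0) (f 4) (f 8) (g 2) (g 6) ⟩
    f 0 + (2 * f 4 + f 8) + (g 2 + g 6) ∎
    where
    f g : ℕ → ℕ
    f a = pairSum₂ (suc b) n φ⟨ a ⟩
    g a = pairSum₁ (suc b) n φ⟨ a ⟩
    ψ : Pair → Vec Pair n → ℕ → ℕ
    ψ x p h = φ (4 * (size x + card p)) (4 * (b * size x + mom (suc b) p) + 2 * suc h)
    moments : ∀ c b m k → 4 * (b * c + m) + 2 * suc k ≡ b * (4 * c) + (4 * m + 2 * suc k)
    moments = solve-∀
    -- The departing particle belongs to `4 * (c + 1)`, split as the marked letter `4 * c + 2` and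
    -- the `2` that the arrival further up adds.
    leaving : ∀ x (p : Vec Pair n) h → bit (proj₂ x) * vacant p h * ψ x p h ≡
      bit (proj₂ x) * (vacant p h * φ⟨ 4 * bit (proj₁ x) + 2 ⟩ (4 * card p + 2) (4 * mom (suc b) p + 2 * (suc b + h)))
    leaving (c , false) p h = refl
    leaving (c , true)  p h = trans (cong (λ z → z * ψ (c , true) p h) (+-identityʳ (vacant p h)))
      (trans (cong (vacant p h *_) (cong₂ φ (cards′ (bit c) (card p)) (moments′ (bit c) b (mom (suc b) p) h))) (sym (+-identityʳ _)))
      where
      cards′ : ∀ c t → 4 * (c + 1 + t) ≡ 4 * c + 2 + (4 * t + 2)
      cards′ = solve-∀
      moments′ : ∀ c b m h → 4 * (b * (c + 1) + m) + 2 * suc h ≡ b * (4 * c + 2) + (4 * m + 2 * (suc b + h))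
      moments′ = solve-∀
    hooks : ∀ x p → ∑ (upTo (suc n)) (λ h → upHooks (suc h) (x ∷ p) * ψ x p h) ≡
      bit (proj₂ x) * ∑ (upTo n) (λ k → vacant p k * φ⟨ 4 * bit (proj₁ x) + 2 ⟩ (4 * card p + 2) (4 * mom (suc b) p + 2 * (suc b + k)))
      + ∑ (upTo n) (λ h → upHooks (suc h) p * φ⟨ 4 * size x ⟩ (4 * card p) (4 * mom (suc b) p + 2 * suc h))
    hooks x p = begin
      ∑ (upTo (suc n)) (λ h → upHooks (suc h) (x ∷ p) * ψ x p h)
        ≡⟨ ∑-upTo-last n _ ⟩
      ∑ (upTo n) (λ h → upHooks (suc h) (x ∷ p) * ψ x p h) + upHooks (suc n) (x ∷ p) * ψ x p n
        -- A hook of length `suc n` does not fit into `suc n` positions; dropping it aligns the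
        -- range with that of the tail.
        ≡⟨ cong (λ z → ∑ (upTo n) (λ h → upHooks (suc h) (x ∷ p) * ψ x p h) + z * ψ x p n) (upHooks-outside (x ∷ p) (suc n) ≤-refl) ⟩
      ∑ (upTo n) (λ h → upHooks (suc h) (x ∷ p) * ψ x p h) + 0
        ≡⟨ +-identityʳ _ ⟩
      ∑ (upTo n) (λ h → upHooks (suc h) (x ∷ p) * ψ x p h)
        ≡⟨ ∑-cong (upTo n) (λ h → trans (cong (_* ψ x p h) (upHooks-∷ x p h))
             (trans (*-distribʳ-+ (ψ x p h) (bit (proj₂ x) * vacant p h) (upHooks (suc h) p))
               (cong₂ _+_ (leaving x p h) (cong (upHooks (suc h) p *_)
                 (cong₂ φ (*-distribˡ-+ 4 (size x) (card p)) (moments (size x) b (mom (suc b) p) h)))))) ⟩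
      ∑ (upTo n) (λ h → bit (proj₂ x) * (vacant p h * φ⟨ 4 * bit (proj₁ x) + 2 ⟩ (4 * card p + 2) (4 * mom (suc b) p + 2 * (suc b + h)))
                        + upHooks (suc h) p * φ⟨ 4 * size x ⟩ (4 * card p) (4 * mom (suc b) p + 2 * suc h))
        ≡⟨ trans (∑-+ (upTo n) _ _) (cong₂ _+_ (∑-*ˡ (upTo n) (bit (proj₂ x)) _) refl) ⟩
      _ ∎
    collect : ∀ x y z u w → x + ((1 * u + y) + (y + ((1 * w + z) + 0))) ≡ x + (2 * y + z) + (u + w)
    collect = solve-∀

letters-cong : ∀ {f f′ : ℕ → ℕ} → (∀ a → f a ≡ f′ a) → f 0 + (2 * f 4 + f 8) ≡ f′ 0 + (2 * f′ 4 + f′ 8)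
letters-cong h = cong₂ _+_ (h 0) (cong₂ (λ x y → 2 * x + y) (h 4) (h 8))

markedSum₀ : ∀ b n φ → markedSum 0 b n φ ≡ pairSum₀ b n φ
markedSum₀ b zero    φ = trans (∑-single [] _) (trans (+-identityʳ (φ 0 0)) (sym (∑-single [] _)))
markedSum₀ b (suc n) φ = trans (markedSum-zero-suc b n φ) (trans
  (letters-cong {λ a → markedSum 0 (suc b) n (shift a (b * a) φ)} (λ a → markedSum₀ (suc b) n (shift a (b * a) φ)))
  (sym (pairSum₀-suc b n φ)))

markedSum₁ : ∀ b n φ → markedSum 1 b n φ ≡ pairSum₁ b n φ
markedSum₁ b zero    φ = trans (∑-single [] _) (sym (trans (∑-single [] _) (∑-[] _)))
markedSum₁ b (suc n) φ = trans (markedSum-suc-suc b n φ 0) (trans (cong₂ _+_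
  (letters-cong {λ a → markedSum 1 (suc b) n (shift a (b * a) φ)} (λ a → markedSum₁ (suc b) n (shift a (b * a) φ)))
  (cong₂ _+_ (markedSum₀ (suc b) n (shift 2 (b * 2) φ)) (markedSum₀ (suc b) n (shift 6 (b * 6) φ))))
  (sym (pairSum₁-suc b n φ)))

markedSum₂ : ∀ b n φ → markedSum 2 b n φ ≡ pairSum₂ b n φ
markedSum₂ b zero    φ = trans (∑-single [] _) (sym (trans (∑-single [] _) (∑-[] _)))
markedSum₂ b (suc n) φ = trans (markedSum-suc-suc b n φ 1) (trans (cong₂ _+_
  (letters-cong {λ a → markedSum 2 (suc b) n (shift a (b * a) φ)} (λ a → markedSum₂ (suc b) n (shift a (b * a) φ)))
  (cong₂ _+_ (markedSum₁ (suc b) n (shift 2 (b * 2) φ)) (markedSum₁ (suc b) n (shift 6 (b * 6) φ))))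
  (sym (pairSum₂-suc b n φ)))

-- Energy relative to the vacuum

-- Truncated subtraction makes particles below `K` and holes above it free, so the vacuum, filled
-- exactly below `K`, has energy `0`.
cost : ℕ → ℕ → Bool → ℕ
cost K i true  = i ∸ K
cost K i false = K ∸ i

energy : ℕ → ℕ → Vec Pair n → ℕ
energy K b []            = 0
energy K b ((c , d) ∷ p) = cost K b c + cost K b d + energy K (suc b) p

gaps : ℕ → ℕ → ℕ → ℕ
gaps K b zero    = 0
gaps K b (suc n) = (K ∸ b) + gaps K (suc b) n

bit-cost : ∀ K i d → i * bit d + (K ∸ i) ≡ K * bit d + cost K i d
bit-cost K i false = cong₂ _+_ (trans (*-zeroʳ i) (sym (*-zeroʳ K))) refl
bit-cost K i true  rewrite *-identityʳ i | *-identityʳ K with ≤-total i K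
... | inj₁ i≤K = trans (m+[n∸m]≡n i≤K) (sym (trans (cong (K +_) (m≤n⇒m∸n≡0 i≤K)) (+-identityʳ K)))
... | inj₂ K≤i = trans (trans (cong (i +_) (m≤n⇒m∸n≡0 K≤i)) (+-identityʳ i)) (sym (m+[n∸m]≡n K≤i))

-- The sum of `bit-cost` over both diagrams; `gaps K b n` is the energy of one diagram without
-- particles.
mom-energy : ∀ K b (p : Vec Pair n) → mom b p + 2 * gaps K b n ≡ K * card p + energy K b p
mom-energy K b []                      = sym (trans (+-identityʳ (K * 0)) (*-zeroʳ K))
mom-energy {suc n} K b ((c , d) ∷ p) = begin
  b * (bit c + bit d) + mom (suc b) p + 2 * (K ∸ b + gaps K (suc b) n)
    ≡⟨ left b (bit c) (bit d) (mom (suc b) p) (K ∸ b) (gaps K (suc b) n) ⟩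
  (b * bit c + (K ∸ b)) + (b * bit d + (K ∸ b)) + (mom (suc b) p + 2 * gaps K (suc b) n)
    ≡⟨ cong₂ _+_ (cong₂ _+_ (bit-cost K b c) (bit-cost K b d)) (mom-energy K (suc b) p) ⟩
  (K * bit c + cost K b c) + (K * bit d + cost K b d) + (K * card p + energy K (suc b) p)
    ≡⟨ right K (bit c) (bit d) (card p) (cost K b c) (cost K b d) (energy K (suc b) p) ⟩
  K * (bit c + bit d + card p) + (cost K b c + cost K b d + energy K (suc b) p) ∎
  where
  left : ∀ b c d m x g → b * (c + d) + m + 2 * (x + g) ≡ (b * c + x) + (b * d + x) + (m + 2 * g)
  left = solve-∀
  right : ∀ K c d t x y e → (K * c + x) + (K * d + y) + (K * t + e) ≡ K * (c + d + t) + (x + y + e)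
  right = solve-∀

gaps-beyond : ∀ K b n → K ≤ b → gaps K b n ≡ 0
gaps-beyond K b zero    K≤b = refl
gaps-beyond K b (suc n) K≤b = cong₂ _+_ (m≤n⇒m∸n≡0 K≤b) (gaps-beyond K (suc b) n (m≤n⇒m≤1+n K≤b))

gaps-positions : ∀ K b n m → b + n ≡ K → gaps K b (n + m) + positions b n ≡ n * K
gaps-positions K b zero    m eq = trans (+-identityʳ _) (gaps-beyond K b m (≤-reflexive (trans (sym eq) (+-identityʳ b))))
gaps-positions K b (suc n) m eq = begin
  (K ∸ b) + gaps K (suc b) (n + m) + (b + positions (suc b) n)
    ≡⟨ regroup (K ∸ b) (gaps K (suc b) (n + m)) b (positions (suc b) n) ⟩
  (K ∸ b) + b + (gaps K (suc b) (n + m) + positions (suc b) n)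
    ≡⟨ cong₂ _+_ (m∸n+n≡m (≤-trans (m≤m+n b (suc n)) (≤-reflexive eq)))
                 (gaps-positions K (suc b) n m (trans (sym (+-suc b n)) eq)) ⟩
  suc n * K ∎
  where
  regroup : ∀ x g b s → x + g + (b + s) ≡ x + b + (g + s)
  regroup = solve-∀

occupied-bit : (p : Vec Pair n) → ∀ j → j < n → (occupied p j ≡ 0 × vacant p j ≡ 1) ⊎ (occupied p j ≡ 1 × vacant p j ≡ 0)
occupied-bit ((_ , false) ∷ p) zero    _         = inj₁ (refl , refl)
occupied-bit ((_ , true) ∷ p)  zero    _         = inj₂ (refl , refl)
occupied-bit (_ ∷ p)           (suc j) (s≤s j<n) = occupied-bit p j j<n

-- One hole already costs this much. Together with `occupied-energy` it makes a diagram of small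
-- energy full at the bottom of the window and empty at its top.
vacant-energy : ∀ K b (p : Vec Pair n) j → vacant p j ≡ 1 → K ∸ (b + j) ≤ energy K b p
vacant-energy K b ((c , false) ∷ p) zero    _ = ≤-trans (≤-trans (≤-reflexive (cong (K ∸_) (+-identityʳ b))) (m≤n+m _ (cost K b c))) (m≤m+n _ _)
vacant-energy K b ((c , d) ∷ p)     (suc j) v = ≤-trans (≤-trans (≤-reflexive (cong (K ∸_) (+-suc b j))) (vacant-energy K (suc b) p j v)) (m≤n+m _ _)

occupied-energy : ∀ K b (p : Vec Pair n) j → occupied p j ≡ 1 → b + j ∸ K ≤ energy K b p
occupied-energy K b ((c , true) ∷ p) zero    _ = ≤-trans (≤-trans (≤-reflexive (cong (_∸ K) (+-identityʳ b))) (m≤n+m _ (cost K b c))) (m≤m+n _ _)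
occupied-energy K b ((c , d) ∷ p)    (suc j) o = ≤-trans (≤-trans (≤-reflexive (cong (_∸ K) (+-suc b j))) (occupied-energy K (suc b) p j o)) (m≤n+m _ _)

flip : ℕ → Vec Pair n → Vec Pair n
flip j       []            = []
flip zero    ((c , d) ∷ p) = (c , not d) ∷ p
flip (suc j) (x ∷ p)       = x ∷ flip j p

-- Flipping one bit permutes the words. A position outside the window is harmless because `flip`
-- then changes nothing.
∑-flip : ∀ n j (f : Vec Pair n → ℕ) → ∑ (words pairs n) (f ∘ flip j) ≡ ∑ (words pairs n) f
∑-flip zero    j       f = trans (∑-single [] _) (sym (∑-single [] _))
∑-flip (suc n) (suc j) f = trans (∑-words-suc n pairs _)
  (trans (∑-cong pairs (λ x → ∑-flip n j (f ∘ (x ∷_)))) (sym (∑-words-suc n pairs f)))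
∑-flip (suc n) zero    f = begin
  ∑ (words pairs (suc n)) (f ∘ flip 0)
    ≡⟨ trans (∑-words-suc n pairs _) (pairs-letters _) ⟩
  s false true + (s false false + (s true true + (s true false + 0)))
    ≡⟨ swap (s false true) (s false false) (s true true) (s true false) ⟩
  s false false + (s false true + (s true false + (s true true + 0)))
    ≡⟨ trans (∑-words-suc n pairs _) (pairs-letters _) ⟨
  ∑ (words pairs (suc n)) f ∎
  where
  s : Bool → Bool → ℕ
  s c d = ∑ (words pairs n) (λ p → f ((c , d) ∷ p))
  swap : ∀ x y z w → x + (y + (z + (w + 0))) ≡ y + (x + (w + (z + 0)))
  swap = solve-∀

vacant-flip : (p : Vec Pair n) → ∀ j → vacant (flip j p) j ≡ occupied p j
vacant-flip []                j       = refl
vacant-flip ((_ , false) ∷ p) zero    = refl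
vacant-flip ((_ , true) ∷ p)  zero    = refl
vacant-flip (_ ∷ p)           (suc j) = vacant-flip p j

occupied-flip : (p : Vec Pair n) → ∀ j → occupied (flip j p) j ≡ vacant p j
occupied-flip []            j       = refl
occupied-flip ((_ , d) ∷ p) zero    = refl
occupied-flip (_ ∷ p)       (suc j) = occupied-flip p j

occupied-flip-≢ : (p : Vec Pair n) → ∀ i j → i ≢ j → occupied (flip i p) j ≡ occupied p j
occupied-flip-≢ []      i       j       _   = refl
occupied-flip-≢ (_ ∷ p) zero    zero    i≢j = contradiction refl i≢j
occupied-flip-≢ (_ ∷ p) zero    (suc j) _   = refl
occupied-flip-≢ (_ ∷ p) (suc i) zero    _   = refl
occupied-flip-≢ (_ ∷ p) (suc i) (suc j) i≢j = occupied-flip-≢ p i j (i≢j ∘ cong suc)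

fill : ∀ b (p : Vec Pair n) j → vacant p j ≡ 1 →
  card (flip j p) ≡ suc (card p) × mom b (flip j p) ≡ mom b p + (b + j)
fill b ((c , false) ∷ p) zero    _ = cong (_+ card p) (+-suc (bit c) 0) , step b (bit c) (mom (suc b) p)
  where
  step : ∀ b c m → b * (c + 1) + m ≡ b * (c + 0) + m + (b + 0)
  step = solve-∀
fill b (x ∷ p)           (suc j) v with fill (suc b) p j v
... | e₁ , e₂ = trans (cong (size x +_) e₁) (+-suc (size x) (card p)) ,
  trans (cong (b * size x +_) e₂) (step (b * size x) (mom (suc b) p) b j)
  where
  step : ∀ x m b j → x + (m + (suc b + j)) ≡ x + m + (b + suc j)
  step = solve-∀

empty : ∀ b (p : Vec Pair n) j → occupied p j ≡ 1 →
  suc (card (flip j p)) ≡ card p × mom b (flip j p) + (b + j) ≡ mom b p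
empty b ((c , true) ∷ p) zero    _ = cong (_+ card p) (sym (+-suc (bit c) 0)) , step b (bit c) (mom (suc b) p)
  where
  step : ∀ b c m → b * (c + 0) + m + (b + 0) ≡ b * (c + 1) + m
  step = solve-∀
empty b (x ∷ p)          (suc j) o with empty (suc b) p j o
... | e₁ , e₂ = trans (sym (+-suc (size x) _)) (cong (size x +_) e₁) ,
  trans (step (b * size x) (mom (suc b) (flip j p)) b j) (cong (b * size x +_) e₂)
  where
  step : ∀ x m b j → x + m + (b + suc j) ≡ x + (m + (suc b + j))
  step = solve-∀

∑-*ʳ : (xs : List A) (c : ℕ) (f : A → ℕ) → ∑ xs f * c ≡ ∑ xs (λ x → f x * c)
∑-*ʳ xs c f = trans (*-comm (∑ xs f) c) (trans (sym (∑-*ˡ xs c f)) (∑-cong xs (λ x → *-comm c (f x))))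

δ*δ-cong : ∀ a b c e {x y} → (a ≡ b → c ≡ e → x ≡ y) → x * (δ a b * δ c e) ≡ y * (δ a b * δ c e)
δ*δ-cong a b c e {x} {y} h with a ≟ b | c ≟ e
... | yes p | yes q = cong (_* (δ a b * δ c e)) (h p q)
... | no p  | _     rewrite δ-≢ p = trans (*-zeroʳ x) (sym (*-zeroʳ y))
... | yes _ | no q  rewrite δ-≢ q | *-zeroʳ (δ a b) = trans (*-zeroʳ x) (sym (*-zeroʳ y))

-- Adding and removing hooks

module Hooks (K N : ℕ) (N<K : N < K) where

  W P : ℕ
  W = K + K
  P = positions 0 K

  -- The vacuum pair has `2 * K` particles and moment `2 * P`. Hence the test selects the pairs with
  -- `2 * K` particles in all and `4 * energy + 2 * y = N`.
  test : ℕ → Vec Pair W → ℕ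
  test y p = δ (4 * card p) (8 * K) * δ (4 * mom 0 p + 2 * y) (8 * P + N)

  ⟪_⟫ : (Vec Pair W → ℕ) → ℕ → ℕ
  ⟪ g ⟫ y = ∑ (words pairs W) (λ p → g p * test y p)

  energy-balance : ∀ (p : Vec Pair W) y → 4 * card p ≡ 8 * K → 4 * mom 0 p + 2 * y ≡ 8 * P + N →
    4 * energy K 0 p + 2 * y ≡ N
  energy-balance p y e₁ e₂ = +-cancelˡ-≡ (8 * P) _ _ (trans (regroup P (energy K 0 p) y)
    (trans (cong (λ m → 4 * m + 2 * y) (sym momP)) e₂))
    where
    regroup : ∀ P e y → 8 * P + (4 * e + 2 * y) ≡ 4 * (2 * P + e) + 2 * y
    regroup = solve-∀
    card≡2K : card p ≡ 2 * K
    card≡2K = *-cancelˡ-≡ (card p) (2 * K) 4 (trans e₁ (*-assoc 4 2 K))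
    square : ∀ g P e → 2 * (g + P) + e ≡ 2 * g + (2 * P + e)
    square = solve-∀
    double-* : ∀ K e → K * (2 * K) + e ≡ 2 * (K * K) + e
    double-* = solve-∀
    momP : mom 0 p ≡ 2 * P + energy K 0 p
    momP = +-cancelˡ-≡ (2 * gaps K 0 W) _ _ (begin
      2 * gaps K 0 W + mom 0 p             ≡⟨ +-comm (2 * gaps K 0 W) _ ⟩
      mom 0 p + 2 * gaps K 0 W             ≡⟨ mom-energy K 0 p ⟩
      K * card p + energy K 0 p            ≡⟨ cong (λ c → K * c + energy K 0 p) card≡2K ⟩
      K * (2 * K) + energy K 0 p           ≡⟨ double-* K (energy K 0 p) ⟩
      2 * (K * K) + energy K 0 p           ≡⟨ cong (λ s → 2 * s + energy K 0 p) (gaps-positions K 0 K K refl) ⟨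
      2 * (gaps K 0 W + P) + energy K 0 p  ≡⟨ square (gaps K 0 W) P (energy K 0 p) ⟩
      2 * gaps K 0 W + (2 * P + energy K 0 p) ∎)

  -- Flipping both ends turns an addable hook into a removable one and raises the moment by the hook
  -- length, which is the same as raising `y` by twice that length. Without a hook at `j` both sides
  -- are `0`.
  moveParticle : ∀ h y (p : Vec Pair W) j → let p′ = flip j (flip (j + suc h) p) in
    vacant p′ j * occupied p′ (j + suc h) * test y p′ ≡ occupied p j * vacant p (j + suc h) * test (2 * suc h + y) p
  moveParticle h y p j = trans (cong (_* test y p′) (cong₂ _*_ v≡o o≡v)) (cases (j <? W) (j + suc h <? W))
    where
    q p′ : Vec Pair W
    q  = flip (j + suc h) p
    p′ = flip j q
    j+h≢j : j + suc h ≢ j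
    j+h≢j = m+1+n≢m j
    v≡o : vacant p′ j ≡ occupied p j
    v≡o = trans (vacant-flip q j) (occupied-flip-≢ p (j + suc h) j j+h≢j)
    o≡v : occupied p′ (j + suc h) ≡ vacant p (j + suc h)
    o≡v = trans (occupied-flip-≢ q j (j + suc h) (j+h≢j ∘ sym)) (occupied-flip p (j + suc h))
    Goal : Set
    Goal = occupied p j * vacant p (j + suc h) * test y p′ ≡ occupied p j * vacant p (j + suc h) * test (2 * suc h + y) p
    occupied≡0 : occupied p j ≡ 0 → Goal
    occupied≡0 o rewrite o = refl
    vacant≡0 : vacant p (j + suc h) ≡ 0 → Goal
    vacant≡0 v rewrite v | *-zeroʳ (occupied p j) = refl
    moves : occupied p j ≡ 1 → vacant p (j + suc h) ≡ 1 → test y p′ ≡ test (2 * suc h + y) p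
    moves o v = cong₂ (λ c s → δ (4 * c) (8 * K) * δ s (8 * P + N)) card≡ (trans (cong (λ m → 4 * m + 2 * y) mom≡) (regroup (mom 0 p) (suc h) y))
      where
      regroup : ∀ m h y → 4 * (m + h) + 2 * y ≡ 4 * m + 2 * (2 * h + y)
      regroup = solve-∀
      filled  = fill 0 p (j + suc h) v
      emptied = empty 0 q j (trans (occupied-flip-≢ p (j + suc h) j j+h≢j) o)
      card≡ : card p′ ≡ card p
      card≡ = suc-injective (trans (proj₁ emptied) (proj₁ filled))
      comm : ∀ m j h → m + (j + h) ≡ m + h + j
      comm = solve-∀
      mom≡ : mom 0 p′ ≡ mom 0 p + suc h
      mom≡ = +-cancelʳ-≡ j _ _ (trans (proj₂ emptied) (trans (proj₂ filled) (comm (mom 0 p) j (suc h))))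
    cases : _ → _ → Goal
    cases (no j≮W) _         = occupied≡0 (occupied-outside p j (≮⇒≥ j≮W))
    cases (yes _)  (no i≮W)  = vacant≡0 (vacant-outside p (j + suc h) (≮⇒≥ i≮W))
    cases (yes j<W) (yes i<W) with occupied-bit p j j<W | occupied-bit p (j + suc h) i<W
    ... | inj₁ (o , _) | _            = occupied≡0 o
    ... | inj₂ _       | inj₂ (_ , v) = vacant≡0 v
    ... | inj₂ (o , _) | inj₁ (_ , v) = cong (occupied p j * vacant p (j + suc h) *_) (moves o v)

  downHooks≡upHooks : ∀ h y → ⟪ downHooks (suc h) ⟫ y ≡ ⟪ upHooks (suc h) ⟫ (2 * suc h + y)
  downHooks≡upHooks h y = begin
    ⟪ downHooks (suc h) ⟫ y
      ≡⟨ ∑-cong Ω (λ p → ∑-*ʳ (upTo W) (test y p) _) ⟩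
    ∑ Ω (λ p → ∑ (upTo W) (λ j → vacant p j * occupied p (j + suc h) * test y p))
      ≡⟨ ∑-comm Ω (upTo W) _ ⟩
    ∑ (upTo W) (λ j → ∑ Ω (λ p → vacant p j * occupied p (j + suc h) * test y p))
      -- For fixed `j` the two flips permute the words, so the inner sum can be reindexed by them.
      ≡⟨ ∑-cong (upTo W) (λ j → trans (sym (trans (∑-flip W (j + suc h) _) (∑-flip W j _))) (∑-cong Ω (λ p → moveParticle h y p j))) ⟩
    ∑ (upTo W) (λ j → ∑ Ω (λ p → occupied p j * vacant p (j + suc h) * test (2 * suc h + y) p))
      ≡⟨ ∑-comm Ω (upTo W) _ ⟨
    ∑ Ω (λ p → ∑ (upTo W) (λ j → occupied p j * vacant p (j + suc h) * test (2 * suc h + y) p))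
      ≡⟨ ∑-cong Ω (λ p → sym (∑-*ʳ (upTo W) (test (2 * suc h + y) p) _)) ⟩
    ⟪ upHooks (suc h) ⟫ (2 * suc h + y) ∎
    where
    Ω : List (Vec Pair W)
    Ω = words pairs W

  -- The difference telescopes: occupied j · vacant i - vacant j · occupied i = occupied j - occupied i for i = j + h.
  upHooks≡downHooks+h : ∀ h (p : Vec Pair W) → energy K 0 p + h < K → upHooks h p ≡ downHooks h p + h
  upHooks≡downHooks+h h p small = +-cancelʳ-≡ later _ _ (begin
    upHooks h p + later
      ≡⟨ trans (sym (∑-+ (upTo W) _ _)) (trans (∑-upTo-cong W exchange) (∑-+ (upTo W) _ _)) ⟩
    downHooks h p + ∑ (upTo W) (occupied p)
      ≡⟨ cong (downHooks h p +_) telescope ⟩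
    downHooks h p + (h + later)
      ≡⟨ +-assoc (downHooks h p) h later ⟨
    downHooks h p + h + later ∎)
    where
    later : ℕ
    later = ∑ (upTo W) (λ j → occupied p (j + h))
    -- A hole at `j < h` would cost `K - j`, more than the available energy.
    bottom-occupied : ∀ j → j < h → occupied p j ≡ 1
    bottom-occupied j j<h with occupied-bit p j (≤-trans j<h (≤-trans (≤-trans (m≤n+m h _) (<⇒≤ small)) (m≤m+n K K)))
    ... | inj₂ (o , _) = o
    ... | inj₁ (_ , v) = contradiction (≤-<-trans K≤ (<-trans (+-monoʳ-< (energy K 0 p) j<h) small)) (<-irrefl refl)
      where
      K≤ : K ≤ energy K 0 p + j
      K≤ = ≤-trans (m≤n+m∸n K j) (≤-trans (+-monoʳ-≤ j (vacant-energy K 0 p j v)) (≤-reflexive (+-comm j _)))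
    -- A particle this high costs at least `K - h`, again more than the available energy.
    top-vacant : ∀ j → j < W → W ≤ j + h → occupied p j ≡ 0
    top-vacant j j<W W≤j+h with occupied-bit p j j<W
    ... | inj₁ (o , _) = o
    ... | inj₂ (o , _) = contradiction (≤-<-trans K≤ small) (<-irrefl refl)
      where
      K≤ : K ≤ energy K 0 p + h
      K≤ = +-cancelˡ-≤ K _ _ (≤-trans W≤j+h (≤-trans (+-monoˡ-≤ h (≤-trans (m≤n+m∸n j K) (+-monoʳ-≤ K (occupied-energy K 0 p j o))))
             (≤-reflexive (+-assoc K (energy K 0 p) h))))
    exchange : ∀ j → j < W → occupied p j * vacant p (j + h) + occupied p (j + h) ≡ vacant p j * occupied p (j + h) + occupied p j
    exchange j j<W with j + h <? W
    -- Outside the window `vacant` is `0` as well as `occupied`, so the exchange holds here only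
    -- because `j` itself is empty.
    ... | no j+h≮W rewrite top-vacant j j<W (≮⇒≥ j+h≮W) | occupied-outside p (j + h) (≮⇒≥ j+h≮W) = sym (trans (+-identityʳ _) (*-zeroʳ (vacant p j)))
    ... | yes j+h<W with occupied-bit p j j<W | occupied-bit p (j + h) j+h<W
    ...   | inj₁ (o , v) | inj₁ (o′ , _)  rewrite o | v | o′ = refl
    ...   | inj₁ (o , v) | inj₂ (o′ , _)  rewrite o | v | o′ = refl
    ...   | inj₂ (o , v) | inj₁ (o′ , v′) rewrite o | v | o′ | v′ = refl
    ...   | inj₂ (o , v) | inj₂ (o′ , v′) rewrite o | v | o′ | v′ = refl
    ∑-one : ∀ m → ∑ (upTo m) (λ _ → 1) ≡ m
    ∑-one zero    = ∑-[] _
    ∑-one (suc m) = trans (∑-upTo-suc m _) (cong suc (∑-one m))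
    telescope : ∑ (upTo W) (occupied p) ≡ h + later
    telescope = begin
      ∑ (upTo W) (occupied p)
        ≡⟨ +-identityʳ _ ⟨
      ∑ (upTo W) (occupied p) + 0
        ≡⟨ cong (∑ (upTo W) (occupied p) +_) (trans (∑-cong (upTo h) (λ j → occupied-outside p (W + j) (m≤m+n W j))) (∑-zero (upTo h))) ⟨
      ∑ (upTo W) (occupied p) + ∑ (upTo h) (λ j → occupied p (W + j))
        ≡⟨ ∑-upTo-+ W h (occupied p) ⟨
      ∑ (upTo (W + h)) (occupied p)
        ≡⟨ cong (λ m → ∑ (upTo m) (occupied p)) (+-comm W h) ⟩
      ∑ (upTo (h + W)) (occupied p)
        ≡⟨ ∑-upTo-+ h W (occupied p) ⟩
      ∑ (upTo h) (occupied p) + ∑ (upTo W) (λ j → occupied p (h + j))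
        ≡⟨ cong₂ _+_ (trans (∑-upTo-cong h bottom-occupied) (∑-one h)) (∑-cong (upTo W) (λ j → cong (occupied p) (+-comm h j))) ⟩
      h + later ∎

  count : ℕ → ℕ
  count = ⟪ (λ _ → 1) ⟫

  -- The surplus of addable hooks gives the `count` term, and the removable hooks reappear as
  -- addable ones at a larger `y`. The bound on `h` gives `energy + suc h ≤ 4 * energy + 2 * y = N <
  -- K`.
  upHooks-step : ∀ h y → suc h ≤ y → ⟪ upHooks (suc h) ⟫ y ≡ suc h * count y + ⟪ upHooks (suc h) ⟫ (2 * suc h + y)
  upHooks-step h y h≤y = begin
    ⟪ upHooks (suc h) ⟫ y
      ≡⟨ ∑-cong Ω (λ p → δ*δ-cong (4 * card p) (8 * K) (4 * mom 0 p + 2 * y) (8 * P + N) (λ e₁ e₂ → upHooks≡downHooks+h (suc h) p (small p e₁ e₂))) ⟩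
    ∑ Ω (λ p → (downHooks (suc h) p + suc h) * test y p)
      ≡⟨ ∑-cong Ω (λ p → distr (downHooks (suc h) p) (suc h) (test y p)) ⟩
    ∑ Ω (λ p → suc h * (1 * test y p) + downHooks (suc h) p * test y p)
      ≡⟨ trans (∑-+ Ω _ _) (cong₂ _+_ (∑-*ˡ Ω (suc h) _) (downHooks≡upHooks h y)) ⟩
    suc h * count y + ⟪ upHooks (suc h) ⟫ (2 * suc h + y) ∎
    where
    Ω : List (Vec Pair W)
    Ω = words pairs W
    distr : ∀ d h t → (d + h) * t ≡ h * (1 * t) + d * t
    distr = solve-∀
    split : ∀ e y → e + y + (3 * e + y) ≡ 4 * e + 2 * y
    split = solve-∀
    small : ∀ p → 4 * card p ≡ 8 * K → 4 * mom 0 p + 2 * y ≡ 8 * P + N → energy K 0 p + suc h < K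
    small p e₁ e₂ = ≤-<-trans (≤-trans (+-monoʳ-≤ (energy K 0 p) h≤y)
      (≤-trans (m≤m+n _ (3 * energy K 0 p + y)) (≤-reflexive (trans (split (energy K 0 p) y) (energy-balance p y e₁ e₂))))) N<K

  ⟪⟫-vanishes : ∀ g y → (∀ p → 4 * card p ≡ 8 * K → 4 * mom 0 p + 2 * y ≢ 8 * P + N) → ⟪ g ⟫ y ≡ 0
  ⟪⟫-vanishes g y h = trans (∑-cong (words pairs W) (λ p →
    δ*δ-cong (4 * card p) (8 * K) (4 * mom 0 p + 2 * y) (8 * P + N) {g p} {0} (λ e₁ e₂ → contradiction e₂ (h p e₁)))) (∑-zero (words pairs W))

  -- Each step raises `y` by twice the hook length, so starting from the hook length it runs through
  -- the odd multiples.
  upHooks-iterate : ∀ h R → ⟪ upHooks (suc h) ⟫ (suc h) ≡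
    ∑ (upTo R) (λ r → suc h * count (suc h * (1 + 2 * r))) + ⟪ upHooks (suc h) ⟫ (suc h * (1 + 2 * R))
  upHooks-iterate h zero    = sym (trans (cong (_+ ⟪ upHooks (suc h) ⟫ (suc h * 1)) (∑-[] _)) (cong ⟪ upHooks (suc h) ⟫ (*-identityʳ (suc h))))
  upHooks-iterate h (suc R) = begin
    ⟪ upHooks (suc h) ⟫ (suc h)
      ≡⟨ upHooks-iterate h R ⟩
    ∑ (upTo R) t + ⟪ upHooks (suc h) ⟫ (suc h * (1 + 2 * R))
      ≡⟨ cong (∑ (upTo R) t +_) (trans (upHooks-step h _ (m≤m*n (suc h) (1 + 2 * R))) (cong (λ y → t R + ⟪ upHooks (suc h) ⟫ y) (next (suc h) R))) ⟩
    ∑ (upTo R) t + (t R + ⟪ upHooks (suc h) ⟫ (suc h * (1 + 2 * suc R)))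
      ≡⟨ +-assoc (∑ (upTo R) t) (t R) _ ⟨
    ∑ (upTo R) t + t R + ⟪ upHooks (suc h) ⟫ (suc h * (1 + 2 * suc R))
      ≡⟨ cong (_+ ⟪ upHooks (suc h) ⟫ (suc h * (1 + 2 * suc R))) (∑-upTo-last R t) ⟨
    ∑ (upTo (suc R)) t + ⟪ upHooks (suc h) ⟫ (suc h * (1 + 2 * suc R)) ∎
    where
    t : ℕ → ℕ
    t r = suc h * count (suc h * (1 + 2 * r))
    next : ∀ h R → 2 * h + h * (1 + 2 * R) ≡ h * (1 + 2 * suc R)
    next = solve-∀

  upHooks≡counts : ∀ h → ⟪ upHooks (suc h) ⟫ (suc h) ≡ ∑ (upTo K) (λ r → suc h * count (suc h * (1 + 2 * r)))
  upHooks≡counts h = trans (upHooks-iterate h K) (trans (cong (counts +_) (⟪⟫-vanishes (upHooks (suc h)) y tooLarge)) (+-identityʳ counts))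
    where
    y counts : ℕ
    y      = suc h * (1 + 2 * K)
    counts = ∑ (upTo K) (λ r → suc h * count (suc h * (1 + 2 * r)))
    K≤y : K ≤ y
    K≤y = ≤-trans (≤-trans (m≤m+n K (K + 0)) (n≤1+n (2 * K))) (m≤n*m (1 + 2 * K) (suc h))
    -- After `K` rounds `y` is at least `K`, while the energy balance demands `2 * y ≤ N < K`.
    tooLarge : ∀ p → 4 * card p ≡ 8 * K → 4 * mom 0 p + 2 * y ≢ 8 * P + N
    tooLarge p e₁ e₂ = <-irrefl refl (<-≤-trans N<K (≤-trans K≤y (≤-trans (m≤m+n y (y + 0))
      (≤-trans (m≤n+m (2 * y) (4 * energy K 0 p)) (≤-reflexive (energy-balance p y e₁ e₂))))))

-- Divisibility of counts and of symmetric sums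

opaque
  unfolding ∑

  size-letters : (f : ℕ → ℕ) → ∑ pairs (f ∘ size) ≡ ∑ (upTo 3) (λ a → (2 C a) * f a)
  size-letters f = collect (f 0) (f 1) (f 2)
    where
    collect : ∀ x y z → x + (y + (y + (z + 0))) ≡ 1 * x + (2 * y + (1 * z + 0))
    collect = solve-∀

-- Merging the two bits at a position into one letter of weight `2 C a` makes the parity argument
-- for words available to pairs of diagrams.
∑-pairs : ∀ b n φ → ∑ (words pairs n) (λ p → φ (card p) (mom b p)) ≡ stateSum (2 C_) 2 b n φ
∑-pairs b zero    φ = trans (∑-single [] _) (sym (stateSum-zero (2 C_) 2 b φ))
∑-pairs b (suc n) φ = begin
  ∑ (words pairs (suc n)) (λ p → φ (card p) (mom b p))
    ≡⟨ ∑-words-suc n pairs _ ⟩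
  ∑ pairs (λ x → ∑ (words pairs n) (λ p → φ (size x + card p) (b * size x + mom (suc b) p)))
    ≡⟨ ∑-cong pairs (λ x → ∑-pairs (suc b) n (shift (size x) (b * size x) φ)) ⟩
  ∑ pairs (λ x → stateSum (2 C_) 2 (suc b) n (shift (size x) (b * size x) φ))
    ≡⟨ size-letters (λ a → stateSum (2 C_) 2 (suc b) n (shift a (b * a) φ)) ⟩
  ∑ (upTo 3) (λ a → (2 C a) * stateSum (2 C_) 2 (suc b) n (shift a (b * a) φ))
    ≡⟨ stateSum-suc (2 C_) 2 b n φ ⟨
  stateSum (2 C_) 2 b (suc n) φ ∎

2C[1+2k] : ∀ k → 2 ∣ 2 C (1 + 2 * k)
2C[1+2k] zero    = from-yes (2 ∣? 2 C 1)
2C[1+2k] (suc k) = subst (2 ∣_) (sym (k>n⇒nCk≡0 (m+n≤o⇒m≤o 3 {2 * k} (≤-reflexive (big k))))) (2 ∣0)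
  where
  big : ∀ k → 3 + 2 * k ≡ 1 + 2 * (1 + k)
  big = solve-∀

-- Induction on the side of the square. The new border consists of mirrored pairs and a corner: for
-- even `u + B`, and at the corner, `f` itself is divisible; for odd `u + B` the two coefficients
-- add up to `2 * (1 + u + B)`.
symmetric-∑ : (f : ℕ → ℕ → ℕ) → (∀ u v → f u v ≡ f v u) → (∀ u v w → u + v ≡ 2 * w → 4 ∣ f u v) →
  ∀ B → 4 ∣ ∑ (upTo B) (λ u → ∑ (upTo B) (λ v → (1 + 2 * u) * f u v))
symmetric-∑ f f-sym f-even zero    = subst (4 ∣_) (sym (∑-[] _)) (4 ∣0)
symmetric-∑ f f-sym f-even (suc B) = subst (4 ∣_) (sym split)
  (∣m∣n⇒∣m+n (∣m∣n⇒∣m+n (symmetric-∑ f f-sym f-even B) (∑-∣ 4 (upTo B) cross)) (∣n⇒∣m*n (1 + 2 * B) (f-even B B B (double-B B))))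
  where
  double-B : ∀ B → B + B ≡ 2 * B
  double-B = solve-∀
  g : ℕ → ℕ → ℕ
  g u v = (1 + 2 * u) * f u v
  regroup : ∀ x y z w → x + y + (z + w) ≡ x + (y + z) + w
  regroup = solve-∀
  split : ∑ (upTo (suc B)) (λ u → ∑ (upTo (suc B)) (g u)) ≡
    ∑ (upTo B) (λ u → ∑ (upTo B) (g u)) + ∑ (upTo B) (λ u → g u B + g B u) + g B B
  split = begin
    ∑ (upTo (suc B)) (λ u → ∑ (upTo (suc B)) (g u))
      ≡⟨ ∑-upTo-last B _ ⟩
    ∑ (upTo B) (λ u → ∑ (upTo (suc B)) (g u)) + ∑ (upTo (suc B)) (g B)
      ≡⟨ cong₂ _+_ (trans (∑-cong (upTo B) (λ u → ∑-upTo-last B (g u))) (∑-+ (upTo B) _ _)) (∑-upTo-last B (g B)) ⟩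
    ∑ (upTo B) (λ u → ∑ (upTo B) (g u)) + ∑ (upTo B) (λ u → g u B) + (∑ (upTo B) (g B) + g B B)
      ≡⟨ regroup (∑ (upTo B) (λ u → ∑ (upTo B) (g u))) _ _ _ ⟩
    ∑ (upTo B) (λ u → ∑ (upTo B) (g u)) + (∑ (upTo B) (λ u → g u B) + ∑ (upTo B) (g B)) + g B B
      ≡⟨ cong (λ z → ∑ (upTo B) (λ u → ∑ (upTo B) (g u)) + z + g B B) (∑-+ (upTo B) (λ u → g u B) (g B)) ⟨
    ∑ (upTo B) (λ u → ∑ (upTo B) (g u)) + ∑ (upTo B) (λ u → g u B + g B u) + g B B ∎
  cross : ∀ u → 4 ∣ g u B + g B u
  cross u with even⊎odd (u + B)
  ... | inj₁ (w , e) = ∣m∣n⇒∣m+n (∣n⇒∣m*n (1 + 2 * u) (f-even u B w e)) (∣n⇒∣m*n (1 + 2 * B) (subst (4 ∣_) (f-sym u B) (f-even u B w e)))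
  ... | inj₂ (w , e) = divides ((1 + w) * f u B) (begin
    (1 + 2 * u) * f u B + (1 + 2 * B) * f B u  ≡⟨ cong (λ z → (1 + 2 * u) * f u B + (1 + 2 * B) * z) (f-sym B u) ⟩
    (1 + 2 * u) * f u B + (1 + 2 * B) * f u B  ≡⟨ factor u B (f u B) ⟩
    2 * (1 + (u + B)) * f u B                  ≡⟨ cong (λ z → 2 * (1 + z) * f u B) e ⟩
    2 * (1 + (1 + 2 * w)) * f u B              ≡⟨ four w (f u B) ⟩
    (1 + w) * f u B * 4                        ∎)
    where
    factor : ∀ u B x → (1 + 2 * u) * x + (1 + 2 * B) * x ≡ 2 * (1 + (u + B)) * x
    factor = solve-∀
    four : ∀ w x → 2 * (1 + (1 + 2 * w)) * x ≡ (1 + w) * x * 4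
    four = solve-∀

∑-evenOdd : ∀ K (f : ℕ → ℕ) → ∑ (upTo (K + K)) f ≡ ∑ (upTo K) (λ u → f (2 * u)) + ∑ (upTo K) (λ u → f (1 + 2 * u))
∑-evenOdd zero    f = trans (∑-[] f) (sym (cong₂ _+_ (∑-[] (λ u → f (2 * u))) (∑-[] (λ u → f (1 + 2 * u)))))
∑-evenOdd (suc K) f = begin
  ∑ (upTo (suc K + suc K)) f
    ≡⟨ cong (λ m → ∑ (upTo (suc m)) f) (+-suc K K) ⟩
  ∑ (upTo (suc (suc (K + K)))) f
    ≡⟨ trans (∑-upTo-last (suc (K + K)) f) (cong (_+ f (suc (K + K))) (∑-upTo-last (K + K) f)) ⟩
  ∑ (upTo (K + K)) f + f (K + K) + f (suc (K + K))
    ≡⟨ cong₂ (λ x y → x + f (K + y) + f (suc (K + y))) (∑-evenOdd K f) (sym (+-identityʳ K)) ⟩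
  ∑ (upTo K) (λ u → f (2 * u)) + ∑ (upTo K) (λ u → f (1 + 2 * u)) + f (2 * K) + f (1 + 2 * K)
    ≡⟨ regroup (∑ (upTo K) (λ u → f (2 * u))) (∑ (upTo K) (λ u → f (1 + 2 * u))) (f (2 * K)) (f (1 + 2 * K)) ⟩
  ∑ (upTo K) (λ u → f (2 * u)) + f (2 * K) + (∑ (upTo K) (λ u → f (1 + 2 * u)) + f (1 + 2 * K))
    ≡⟨ cong₂ _+_ (∑-upTo-last K (λ u → f (2 * u))) (∑-upTo-last K (λ u → f (1 + 2 * u))) ⟨
  ∑ (upTo (suc K)) (λ u → f (2 * u)) + ∑ (upTo (suc K)) (λ u → f (1 + 2 * u)) ∎
  where
  regroup : ∀ x y z w → x + y + z + w ≡ x + z + (y + w)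
  regroup = solve-∀

∑-mod⁺ : ∀ c d (xs : List A) {f g : A → ℕ} → (∀ x → f x ≡ c * g x mod⁺ d) → ∑ xs f ≡ c * ∑ xs g mod⁺ d
∑-mod⁺ c d xs {f} {g} h = ∑ xs k , (begin
  ∑ xs f                            ≡⟨ ∑-cong xs (λ x → _≡_mod⁺_.equality (h x)) ⟩
  ∑ xs (λ x → c * g x + d * k x)    ≡⟨ trans (∑-+ xs _ _) (cong₂ _+_ (∑-*ˡ xs c g) (∑-*ˡ xs d k)) ⟩
  c * ∑ xs g + d * ∑ xs k           ∎)
  where
  k : _ → ℕ
  k x = _≡_mod⁺_.quotient (h x)

-- The progression `8 * n + 6`

module _ (n : ℕ) where

  private
    N : ℕ
    N = 8 * n + 6
  open Hooks (suc N) N ≤-refl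
  private
    K : ℕ
    K = suc N
    Φ : ℕ → ℕ → ℕ
    Φ c s = δ c (8 * K) * δ s (8 * P + N)

  -- Odd letters come at least in pairs and give `2 * 2`. Without them the moment is even, and the
  -- left side of the moment condition is `2` mod `8` while the right side is `6` mod `8`.
  4∣count : ∀ z → 4 ∣ count (1 + 4 * z)
  4∣count z = subst (4 ∣_) (sym (trans (∑-cong (words pairs W) (λ p → +-identityʳ (test (1 + 4 * z) p)))
      (∑-pairs 0 W (λ c s → δ (4 * c) (8 * K) * δ (4 * s + 2 * (1 + 4 * z)) (8 * P + N)))))
    (∑-∣ 4 (words (upTo 3) W) (λ v → δ*δ-∣ (4 * total v) (8 * K) (4 * moment 0 v + 2 * (1 + 4 * z)) (8 * P + N) (divisible v)))
    where
    left : ∀ m z → 4 * (2 * m) + 2 * (1 + 4 * z) ≡ 2 + 8 * (m + z)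
    left = solve-∀
    right : ∀ P n → 8 * P + (8 * n + 6) ≡ 2 + 4 * (1 + 2 * (P + n))
    right = solve-∀
    halves : ∀ {a b} → 2 + 8 * a ≡ 2 + 4 * (1 + 2 * b) → 2 * a ≡ suc (2 * b)
    halves {a} e = *-cancelˡ-≡ _ _ 4 (trans (sym (*-assoc 4 2 a)) (+-cancelˡ-≡ 2 _ _ e))
    divisible : (v : Vec ℕ W) → 4 * total v ≡ 8 * K → 4 * moment 0 v + 2 * (1 + 4 * z) ≡ 8 * P + N → 4 ∣ weigh (2 C_) v
    divisible v e₁ e₂ with evenTotal (2 C_) 2 2C[1+2k] v (divides K (trans (*-cancelˡ-≡ (total v) (2 * K) 4 (trans e₁ (*-assoc 4 2 K))) (*-comm 2 K)))
    ... | inj₂ q          = q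
    ... | inj₁ (u , refl) = contradiction (halves {moment 0 u + z} {P + n} (trans (sym (left (moment 0 u) z))
      (trans (cong (λ m → 4 * m + 2 * (1 + 4 * z)) (sym (moment-double 0 u))) (trans e₂ (right P n))))) (even≢odd (moment 0 u + z) (P + n))

  4∤6+8m : ∀ {k} → 4 ∣ k → 8 * P + N ≢ k
  4∤6+8m {k} 4∣k e = contradiction
    (∣m+n∣m⇒∣n {4} {4 * (2 * P + 2 * n)} {6} (subst (4 ∣_) (trans (sym e) (regroup P n)) 4∣k) (m∣m*n (2 * P + 2 * n)))
    (from-no (4 ∣? 6))
    where
    regroup : ∀ P n → 8 * P + (8 * n + 6) ≡ 4 * (2 * P + 2 * n) + 6
    regroup = solve-∀

  -- For an even hook length the left side of the moment condition is divisible by `4`, but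
  -- `8 * P + N` is `2` mod `4`.
  evenHooks-vanish : ∀ u → ⟪ upHooks (suc (1 + 2 * u)) ⟫ (suc (1 + 2 * u)) ≡ 0
  evenHooks-vanish u = ⟪⟫-vanishes (upHooks (suc (1 + 2 * u))) (suc (1 + 2 * u)) λ p _ e →
    4∤6+8m (divides (mom 0 p + (1 + u)) (regroup (mom 0 p) u)) (sym e)
    where
    regroup : ∀ m u → 4 * m + 2 * suc (1 + 2 * u) ≡ (m + (1 + u)) * 4
    regroup = solve-∀

  4∣markedSum : 4 ∣ markedSum 2 0 W Φ
  4∣markedSum = subst (4 ∣_) (sym hookSum) (symmetric-∑ f (λ u v → cong count (*-comm (1 + 2 * u) (1 + 2 * v)))
      -- For `u + v = 2 * w` the product of the two odd numbers is `1 + 4 * (w + u * v)`.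
      (λ u v w e → subst (λ y → 4 ∣ count y) (sym (trans (expand u v) (trans (cong (λ s → 1 + 2 * s + 4 * (u * v)) e) (collect w (u * v))))) (4∣count (w + u * v))) K)
    where
    f : ℕ → ℕ → ℕ
    f u v = count ((1 + 2 * u) * (1 + 2 * v))
    expand : ∀ u v → (1 + 2 * u) * (1 + 2 * v) ≡ 1 + 2 * (u + v) + 4 * (u * v)
    expand = solve-∀
    collect : ∀ w t → 1 + 2 * (2 * w) + 4 * t ≡ 1 + 4 * (w + t)
    collect = solve-∀
    Ω : List (Vec Pair W)
    Ω = words pairs W
    hookSum : markedSum 2 0 W Φ ≡ ∑ (upTo K) (λ u → ∑ (upTo K) (λ v → (1 + 2 * u) * f u v))
    hookSum = begin
      markedSum 2 0 W Φ
        ≡⟨ markedSum₂ 0 W Φ ⟩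
      ∑ Ω (λ p → ∑ (upTo W) (λ h → upHooks (suc h) p * test (suc h) p))
        ≡⟨ ∑-comm Ω (upTo W) _ ⟩
      ∑ (upTo W) (λ h → ⟪ upHooks (suc h) ⟫ (suc h))
        -- The index is the hook length minus one, so the even indices carry the odd hooks.
        ≡⟨ ∑-evenOdd K _ ⟩
      ∑ (upTo K) (λ u → ⟪ upHooks (suc (2 * u)) ⟫ (suc (2 * u))) + ∑ (upTo K) (λ u → ⟪ upHooks (suc (1 + 2 * u)) ⟫ (suc (1 + 2 * u)))
        ≡⟨ cong₂ _+_ (∑-cong (upTo K) (λ u → upHooks≡counts (2 * u))) (trans (∑-cong (upTo K) evenHooks-vanish) (∑-zero (upTo K))) ⟩
      ∑ (upTo K) (λ u → ∑ (upTo K) (λ v → (1 + 2 * u) * f u v)) + 0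
        ≡⟨ +-identityʳ _ ⟩
      ∑ (upTo K) (λ u → ∑ (upTo K) (λ v → (1 + 2 * u) * f u v)) ∎

  64∣frobSum[8n+6] : 64 ∣ frobSum 8 N
  64∣frobSum[8n+6] = subst (64 ∣_) (sym (frobSum≡stateSum 8 N)) (conclude (∑-mod⁺ 784 64 (words (upTo 9) W) term))
    where
    -- `784 = 16 * 49`, so divisibility of the marked sum by `4` supplies the missing factor.
    64∣784* : ∀ {x} → 4 ∣ x → 64 ∣ 784 * x
    64∣784* (divides q refl) = divides (49 * q) (regroup q)
      where
      regroup : ∀ q → 784 * (q * 4) ≡ 49 * q * 64
      regroup = solve-∀
    conclude : ∀ {x} → x ≡ 784 * markedSum 2 0 W Φ mod⁺ 64 → 64 ∣ x
    conclude (k , refl) = ∣m∣n⇒∣m+n (64∣784* 4∣markedSum) (m∣m*n k)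
    factor : ∀ a b t → (784 * a + 64 * b) * t ≡ 784 * (a * t) + 64 * (b * t)
    factor = solve-∀
    scale : ∀ w m t → w ≡ 784 * m mod⁺ 64 → w * t ≡ 784 * (m * t) mod⁺ 64
    scale w m t (k , refl) = (k * t) , factor m k t
    zeroTerm : ∀ w m {t} → t ≡ 0 → w * t ≡ 784 * (m * t) mod⁺ 64
    zeroTerm w m refl = 0 , trans (*-zeroʳ w) (sym (trans (+-identityʳ _) (cong (784 *_) (*-zeroʳ m))))
    term : ∀ v → weigh (8 C_) v * Φ (total v) (moment 0 v) ≡ 784 * (marks 2 v * Φ (total v) (moment 0 v)) mod⁺ 64
    term v with total v ≟ 8 * K | moment 0 v ≟ 8 * P + N
    ... | yes e₁ | yes e₂ = scale (weigh (8 C_) v) (marks 2 v) (Φ (total v) (moment 0 v)) (weigh≡784*marks v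
      (subst (4 ∣_) (sym e₁) (∣m⇒∣m*n K (divides 2 refl))) (λ 4∣m → 4∤6+8m 4∣m (sym e₂)))
    ... | no  e₁ | _      = zeroTerm (weigh (8 C_) v) (marks 2 v) (cong (_* δ (moment 0 v) (8 * P + N)) (δ-≢ e₁))
    ... | yes _  | no  e₂ = zeroTerm (weigh (8 C_) v) (marks 2 v)
      (trans (cong (δ (total v) (8 * K) *_) (δ-≢ e₂)) (*-zeroʳ (δ (total v) (8 * K))))

-- The four congruences

-- As `e` divides `8`, it divides the prescribed total, and it divides the prescribed moment only if
-- it divides `N`; so every surviving word satisfies the hypotheses of `term`.
frobSum-∣ : ∀ d e N → e ∣ 8 → ¬ e ∣ N →
  (∀ {n} (v : Vec ℕ n) → e ∣ total v → ¬ e ∣ moment 0 v → d ∣ weigh (8 C_) v) → d ∣ frobSum 8 N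
frobSum-∣ d e N e∣8 e∤N term = subst (d ∣_) (sym (frobSum≡stateSum 8 N)) (∑-∣ d (words (upTo 9) (suc N + suc N)) λ v →
  δ*δ-∣ (total v) (8 * suc N) (moment 0 v) (8 * positions 0 (suc N) + N) λ e₁ e₂ → term v
    (subst (e ∣_) (sym e₁) (∣m⇒∣m*n (suc N) e∣8))
    (λ e∣m → e∤N (∣m+n∣m⇒∣n (subst (e ∣_) e₂ e∣m) (∣m⇒∣m*n (positions 0 (suc N)) e∣8))))

theorem6p4 : (n : ℕ) →
    Σ ℕ (λ m → (CFrob 8 (2 * n + 1) ↔ Fin m) × (64 ∣ m))
    × Σ ℕ (λ m → (CFrob 8 (4 * n + 2) ↔ Fin m) × (16 ∣ m))
    × Σ ℕ (λ m → (CFrob 8 (8 * n + 4) ↔ Fin m) × (4 ∣ m))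
    × Σ ℕ (λ m → (CFrob 8 (8 * n + 6) ↔ Fin m) × (64 ∣ m))
theorem6p4 n =
    (_ , CFrob-↔ 8 (2 * n + 1) , frobSum-∣ 64 2 _ (divides 4 refl) (∤ n (from-no (2 ∣? 1))) odd-term)
  , (_ , CFrob-↔ 8 (4 * n + 2) , frobSum-∣ 16 4 _ (divides 2 refl) (∤ n (from-no (4 ∣? 2))) twiceOdd-term)
  , (_ , CFrob-↔ 8 (8 * n + 4) , frobSum-∣ 4 8 _ (divides 1 refl) (∤ n (from-no (8 ∣? 4))) fourTimesOdd-term)
  , (_ , CFrob-↔ 8 (8 * n + 6) , 64∣frobSum[8n+6] n)
  where
  ∤ : ∀ {e r} n → ¬ e ∣ r → ¬ e ∣ e * n + r
  ∤ n e∤r e∣ = e∤r (∣m+n∣m⇒∣n e∣ (m∣m*n n))
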